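{- For each $n$ let $\delta$ be a uniformly random transition function of an automaton with state set $[n]$ and alphabet $\{a,b\}$. Then, with probability $1-o(1)$ as $n\to\infty$, the following holds: for all pairs of states $x,y\in[n]$ there exists a word $\omega=\omega^{xy}\in\{a,b\}^*$ of length at most $3\log_2 n$ such that $\delta_\omega(x)=\delta_\omega(y)$.
   Context: $[n]=\{1,\dots,n\}$. A random automaton on state set $[n]$ with alphabet $\{a,b\}$ is given by a transition function $\delta:[n]\times\{a,b\}\to[n]$ chosen uniformly among all $n^{2n}$ such functions; equivalently, the values $\delta_c(x):=\delta(x,c)$, for $x\in[n]$, $c\in\{a,b\}$, are independent and uniform on $[n]$. For a word $\omega=\omega_1\omega_2\cdots\omega_m\in\{a,b\}^*$ put $\delta_\omega:=\delta_{\omega_m}\circ\cdots\circ\delta_{\omega_1}$ (the empty word gives the identity). -}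

module Defs where

open import Data.Fin using (Fin)
import Data.Fin.Properties as Fin
open import Data.Integer using (+_)
open import Data.List using (List; []; _∷_; _++_; length; map; foldl; filter; allFin; cartesianProduct; cartesianProductWith)
open import Data.List.Membership.Propositional using (_∈_)
open import Data.List.Membership.Propositional.Properties using (∈-allFin; ∈-cartesianProduct⁺; ∈-cartesianProductWith⁺)
open import Data.List.Properties using (length-++; length-map; length-tabulate)
open import Data.List.Relation.Unary.All using ([])
open import Data.List.Relation.Unary.AllPairs using ([]; _∷_)
open import Data.List.Relation.Unary.Any using (here)
open import Data.List.Relation.Unary.Unique.Propositional using (Unique)
import Data.List.Relation.Unary.Unique.Propositional.Properties as Unique
open import Data.Nat using (ℕ; zero; suc; _+_; _*_; _^_; _≤_; _≥_; z≤n; s≤s; NonZero)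
open import Data.Nat.Logarithm using (⌊log₂_⌋)
open import Data.Nat.Properties using (m^n≢0; ^-distribˡ-+-*; +-identityʳ)
open import Data.Product using (_×_; _,_; ∃-syntax)
open import Data.Rational.Unnormalised as ℚᵘ using (ℚᵘ; 0ℚᵘ; ∣_∣)
open import Data.Vec using (Vec; []; _∷_; lookup; tabulate)
open import Data.Vec.Properties using (∷-injective; lookup∘tabulate)
open import Function using (id)
open import Relation.Binary.PropositionalEquality using (_≡_; refl; sym; trans; cong; cong₂)
open import Relation.Nullary using (Dec; yes; no)
open import Relation.Unary using (Decidable)

data Letter : Set where
  a b : Letter

Word : Set
Word = List Letter

-- A transition function is given by its two tables of values, δ_a and δ_b,
-- so that equality of automata is propositional equality.
Automaton : ℕ → Set
Automaton n = Vec (Fin n) n × Vec (Fin n) n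

δ : ∀ {n} → Automaton n → Letter → Fin n → Fin n
δ (ta , tb) a = lookup ta
δ (ta , tb) b = lookup tb

δ* : ∀ {n} → Automaton n → Word → Fin n → Fin n
δ* A ω x = foldl (λ y c → δ A c y) x ω

-- Every function [n] × {a,b} → [n] is the transition function of an automaton.
fromFunction : ∀ {n} → (Letter → Fin n → Fin n) → Automaton n
fromFunction f = tabulate (f a) , tabulate (f b)

δ-fromFunction : ∀ {n} (f : Letter → Fin n → Fin n) c x → δ (fromFunction f) c x ≡ f c x
δ-fromFunction f a = lookup∘tabulate (f a)
δ-fromFunction f b = lookup∘tabulate (f b)

vectors : ∀ {A : Set} → List A → ∀ k → List (Vec A k)
vectors xs zero    = [] ∷ []
vectors xs (suc k) = cartesianProductWith _∷_ xs (vectors xs k)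

automata : ∀ n → List (Automaton n)
automata n = cartesianProduct (vectors (allFin n) n) (vectors (allFin n) n)

-- The list `automata n` contains each automaton exactly once, and has
-- length n ^ (2 * n).
∈-vectors : ∀ {A : Set} {xs : List A} → (∀ x → x ∈ xs) → ∀ {k} (v : Vec A k) → v ∈ vectors xs k
∈-vectors all∈ []      = here refl
∈-vectors all∈ (x ∷ v) = ∈-cartesianProductWith⁺ _∷_ (all∈ x) (∈-vectors all∈ v)

vectors-unique : ∀ {A : Set} {xs : List A} → Unique xs → ∀ k → Unique (vectors xs k)
vectors-unique xs! zero    = [] ∷ []
vectors-unique xs! (suc k) = Unique.cartesianProductWith⁺ _∷_ ∷-injective xs! (vectors-unique xs! k)

length-cartesianProductWith : ∀ {A B C : Set} (f : A → B → C) xs ys →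
                              length (cartesianProductWith f xs ys) ≡ length xs * length ys
length-cartesianProductWith f []       ys = refl
length-cartesianProductWith f (x ∷ xs) ys =
  trans (length-++ (map (f x) ys))
        (cong₂ _+_ (length-map (f x) ys) (length-cartesianProductWith f xs ys))

length-vectors : ∀ {A : Set} (xs : List A) k → length (vectors xs k) ≡ length xs ^ k
length-vectors xs zero    = refl
length-vectors xs (suc k) =
  trans (length-cartesianProductWith _∷_ xs (vectors xs k))
        (cong (length xs *_) (length-vectors xs k))

∈-automata : ∀ {n} (A : Automaton n) → A ∈ automata n
∈-automata (ta , tb) = ∈-cartesianProduct⁺ (∈-vectors ∈-allFin ta) (∈-vectors ∈-allFin tb)

automata-unique : ∀ n → Unique (automata n)
automata-unique n = Unique.cartesianProduct⁺ vs! vs!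
  where vs! = vectors-unique (Unique.allFin⁺ n) n

length-automata : ∀ n → length (automata n) ≡ n ^ (2 * n)
length-automata n =
  trans (length-cartesianProductWith _,_ (vectors (allFin n) n) (vectors (allFin n) n))
  (trans (cong₂ _*_ eq eq)
  (trans (sym (^-distribˡ-+-* n n n))
         (cong (λ k → n ^ (n + k)) (sym (+-identityʳ n)))))
  where
  eq : length (vectors (allFin n) n) ≡ n ^ n
  eq = trans (length-vectors (allFin n) n) (cong (_^ n) (length-tabulate {n = n} id))

n^2n≢0 : ∀ n → NonZero (n ^ (2 * n))
n^2n≢0 zero    = _
n^2n≢0 (suc n) = m^n≢0 (suc n) (2 * suc n)

-- Probability of the event P for a uniformly random automaton with n states.
Pr : ∀ n {P : Automaton n → Set} → Decidable P → ℚᵘ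
Pr n P? = + length (filter P? (automata n)) ℚᵘ./ (n ^ (2 * n))
  where instance _ = n^2n≢0 n

IsO[1] : (ℕ → ℚᵘ) → Set
IsO[1] f = ∀ ε → 0ℚᵘ ℚᵘ.< ε → ∃[ N ] (∀ n → n ≥ N → ∣ f n ∣ ℚᵘ.≤ ε)

-- As n ^ 3 has binary logarithm 3 log₂ n, a natural number is at most
-- 3 log₂ n (n ≥ 1) if and only if it is at most this integer part.
⌊3log₂_⌋ : ℕ → ℕ
⌊3log₂ n ⌋ = ⌊log₂ (n ^ 3) ⌋

MergeWithin : ∀ {n} → Automaton n → ℕ → Fin n → Fin n → Set
MergeWithin A ℓ x y = ∃[ ω ] (length ω ≤ ℓ × δ* A ω x ≡ δ* A ω y)

AllPairsMerge : ∀ n → Automaton n → Set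
AllPairsMerge n A = ∀ x y → MergeWithin A ⌊3log₂ n ⌋ x y

mergeWithin? : ∀ {n} (A : Automaton n) ℓ x y → Dec (MergeWithin A ℓ x y)
mergeWithin? A ℓ x y with x Fin.≟ y
mergeWithin? A ℓ       x y | yes x≡y = yes ([] , z≤n , x≡y)
mergeWithin? A zero    x y | no  x≢y = no λ { ([] , _ , x≡y) → x≢y x≡y }
mergeWithin? A (suc ℓ) x y | no  x≢y
  with mergeWithin? A ℓ (δ A a x) (δ A a y) | mergeWithin? A ℓ (δ A b x) (δ A b y)
... | yes (ω , ω≤ℓ , eq) | _                  = yes (a ∷ ω , s≤s ω≤ℓ , eq)
... | no  _              | yes (ω , ω≤ℓ , eq) = yes (b ∷ ω , s≤s ω≤ℓ , eq)
... | no  ¬a             | no  ¬b             = no λ where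
  ([]    , _       , eq) → x≢y eq
  (a ∷ ω , s≤s ω≤ℓ , eq) → ¬a (ω , ω≤ℓ , eq)
  (b ∷ ω , s≤s ω≤ℓ , eq) → ¬b (ω , ω≤ℓ , eq)

allPairsMerge? : ∀ n → Decidable (AllPairsMerge n)
allPairsMerge? n A = Fin.all? λ x → Fin.all? λ y → mergeWithin? A ⌊3log₂ n ⌋ x y

{-# OPTIONS --safe #-}
-- Values of the transition function are revealed only when they are needed, so that each revealed value is
-- uniform whatever has been revealed before; a value that lies in the set of h states seen so far (a collision)
-- has probability at most h / n. Let n be about u ^ 12, where u = 2 ^ q.
-- (1) Follow the pair (x , y) along all words, dropping a branch at each collision. Unless three collisions occur
-- among the first O(u) pairs, which has probability O(u ^ 6 / n ^ 3), or some state is fixed by both letters, about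
-- u pairs of distinct fresh states are reached. From then on the number of branches grows fourfold with every three
-- letters, except with probability exponentially small in u, and u ^ 11 branches are obtained.
-- (2) Take disjoint blocks of about u ^ 5 unused states. Following the pairs formed from two blocks along the words
-- of length 9 q in the same manner yields u ^ 11 pairs but only u ^ 9 words, so many states coming from either block
-- have been reached by the same word, and some of them merge in the next step. Except with probability
-- exponentially small in u, every pair of blocks hence contains a pair of states that can be merged without using the
-- u ^ 11 branches of (1), which makes about u ^ 14 mergeable pairs.
-- (3) The next letter takes the branches of (1) to independent uniform pairs, and each of them is one of these
-- mergeable pairs with probability about u ^ 14 / n ^ 2 = u ^ -10. So all u ^ 11 branches fail with probability
-- exponentially small in u.
module Submission where

open import Defs
open import Data.Rational.Unnormalised using (1ℚᵘ; _-_)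

open import Data.Empty using (⊥; ⊥-elim)
open import Data.Fin using (Fin; combine; inject≤) renaming (zero to fzero; suc to fsuc)
import Data.Fin.Properties as Fin
open import Data.Integer as ℤ using (+[1+_]; -[1+_]; +<+; +≤+)
import Data.Integer.Properties as ℤ
open import Data.List using (List; []; _∷_; [_]; _++_; length; map; concat; concatMap; filter; take; drop; lookup; tabulate; allFin; cartesianProduct)
open import Data.List.Membership.Propositional using (_∈_; _∉_)
import Data.List.Membership.DecPropositional as DecMembership
open import Data.List.Membership.Propositional.Properties
  using (∈-allFin; ∈-∃++; ∈-++⁺ˡ; ∈-++⁺ʳ; ∈-++⁻; ∈-map⁺; ∈-map⁻; ∈-filter⁺; ∈-filter⁻; ∈-tabulate⁻; ∈-cartesianProduct⁺; ∈-lookup)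
import Data.List.Properties as List
open import Data.List.Properties using (length-++; length-map; length-tabulate; length-take; foldl-++)
open import Data.List.Relation.Binary.Permutation.Propositional
  using (_↭_; ↭-refl; ↭-sym; ↭-trans; ↭-reflexive; prep; ↭⇒↭ₛ)
import Data.List.Relation.Binary.Permutation.Propositional.Properties as Perm
import Data.List.Relation.Binary.Permutation.Setoid.Properties as PermS
open import Data.List.Relation.Unary.All as All using (All; []; _∷_)
import Data.List.Relation.Unary.All.Properties as All
open import Data.List.Relation.Unary.AllPairs as AllPairs using ([]; _∷_)
import Data.List.Relation.Unary.AllPairs.Properties as AllPairs
open import Data.List.Relation.Unary.Any using (here; there)
open import Data.List.Relation.Unary.Unique.Propositional using (Unique)
import Data.List.Relation.Unary.Unique.Propositional.Properties as Unique
open import Data.Nat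
open import Data.Nat.Logarithm using (⌊log₂_⌋; ⌊log₂⌋-mono-≤; ⌊log₂[2^n]⌋≡n)
open import Data.Nat.Properties
open import Data.Nat.Tactic.RingSolver using (solve-∀)
open import Data.Product using (_×_; _,_; ∃; ∃₂; proj₁; proj₂)
open import Data.Product.Properties using (≡-dec)
import Data.Rational.Unnormalised as ℚᵘ
open ℚᵘ using (mkℚᵘ; 0ℚᵘ; *≤*; *<*; *≡*; ↧ₙ_)
import Data.Rational.Unnormalised.Properties as ℚᵘ
open import Data.Sum using (_⊎_; inj₁; inj₂)
open import Data.Unit using (tt)
open import Data.Vec using (_[_]≔_)
open import Data.Vec.Properties using (lookup∘update; lookup∘update′; []≔-lookup; []≔-idempotent)
open import Function using (id; _∘_; _$_; flip; it; case_of_)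
open import Relation.Binary using (DecidableEquality)
open import Relation.Binary.PropositionalEquality using (_≡_; _≢_; refl; sym; trans; cong; cong₂; subst; setoid)
open import Relation.Nullary using (Dec; yes; no; ¬_; contradiction)
open import Relation.Nullary.Decidable using (decidable-stable; ¬¬-excluded-middle; ¬?; _×-dec_)
open import Relation.Unary using (Decidable)

private variable
  I J : Set
  n : ℕ

-- Finite sums and counting

∑ : List I → (I → ℕ) → ℕ
∑ []       f = 0
∑ (i ∷ is) f = f i + ∑ is f

∑-mono : ∀ (is : List I) {f g : I → ℕ} → (∀ i → f i ≤ g i) → ∑ is f ≤ ∑ is g
∑-mono []       f≤g = z≤n
∑-mono (i ∷ is) f≤g = +-mono-≤ (f≤g i) (∑-mono is f≤g)

∑-cong : ∀ (is : List I) {f g : I → ℕ} → (∀ i → f i ≡ g i) → ∑ is f ≡ ∑ is g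
∑-cong []       f≡g = refl
∑-cong (i ∷ is) f≡g = cong₂ _+_ (f≡g i) (∑-cong is f≡g)

∑-const : ∀ (is : List I) c → ∑ is (λ _ → c) ≡ length is * c
∑-const []       c = refl
∑-const (i ∷ is) c = cong (c +_) (∑-const is c)

∑-+ : ∀ (is : List I) f g → ∑ is (λ i → f i + g i) ≡ ∑ is f + ∑ is g
∑-+ []       f g = refl
∑-+ (i ∷ is) f g = trans (cong (f i + g i +_) (∑-+ is f g)) (lemma (f i) (g i) (∑ is f) (∑ is g))
  where
  lemma : ∀ a b c d → a + b + (c + d) ≡ (a + c) + (b + d)
  lemma = solve-∀

∑-*ˡ : ∀ (is : List I) c f → ∑ is (λ i → c * f i) ≡ c * ∑ is f
∑-*ˡ []       c f = sym (*-zeroʳ c)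
∑-*ˡ (i ∷ is) c f = trans (cong (c * f i +_) (∑-*ˡ is c f)) (sym (*-distribˡ-+ c (f i) (∑ is f)))

∑-*ʳ : ∀ (is : List I) f c → ∑ is (λ i → f i * c) ≡ ∑ is f * c
∑-*ʳ []       f c = refl
∑-*ʳ (i ∷ is) f c = trans (cong (f i * c +_) (∑-*ʳ is f c)) (sym (*-distribʳ-+ c (f i) (∑ is f)))

∑-swap : ∀ (is : List I) (js : List J) (f : I → J → ℕ) → ∑ is (λ i → ∑ js (f i)) ≡ ∑ js (λ j → ∑ is (λ i → f i j))
∑-swap []       js f = sym (trans (∑-const js 0) (*-zeroʳ (length js)))
∑-swap (i ∷ is) js f = trans (cong (∑ js (f i) +_) (∑-swap is js f)) (sym (∑-+ js (f i) (λ j → ∑ is (λ i → f i j))))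

∑-∈ : ∀ {is : List I} {i} → i ∈ is → ∀ f → f i ≤ ∑ is f
∑-∈ (here refl)        f = m≤m+n (f _) _
∑-∈ (there {x} i∈is) f = ≤-trans (∑-∈ i∈is f) (m≤n+m _ (f x))

∑-cartesianProduct : ∀ (is : List I) (js : List J) f →
  ∑ (cartesianProduct is js) f ≡ ∑ is (λ i → ∑ js (λ j → f (i , j)))
∑-cartesianProduct []       js f = refl
∑-cartesianProduct (i ∷ is) js f = trans (++-map js) (cong (∑ js (λ j → f (i , j)) +_) (∑-cartesianProduct is js f))
  where
  ++-map : ∀ js' → ∑ (map (i ,_) js' ++ cartesianProduct is js) f ≡ ∑ js' (λ j → f (i , j)) + ∑ (cartesianProduct is js) f
  ++-map []       = refl
  ++-map (j ∷ js') = trans (cong (f (i , j) +_) (++-map js')) (sym (+-assoc (f (i , j)) _ _))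

⟦_⟧ : ∀ {P : Set} → Dec P → ℕ
⟦ yes _ ⟧ = 1
⟦ no _  ⟧ = 0

⟦⟧-yes : ∀ {P : Set} (P? : Dec P) → P → ⟦ P? ⟧ ≡ 1
⟦⟧-yes (yes _) p = refl
⟦⟧-yes (no ¬p) p = contradiction p ¬p

⟦⟧-no : ∀ {P : Set} (P? : Dec P) → ¬ P → ⟦ P? ⟧ ≡ 0
⟦⟧-no (yes p) ¬p = contradiction p ¬p
⟦⟧-no (no _)  ¬p = refl

length-filter-∷ : ∀ {P : I → Set} (P? : Decidable P) x xs →
  length (filter P? (x ∷ xs)) ≡ ⟦ P? x ⟧ + length (filter P? xs)
length-filter-∷ P? x xs with P? x
... | yes px = refl
... | no ¬px = refl

length≤∑-fibres : ∀ (f : I → Fin n) xs →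
  length xs ≤ ∑ (allFin n) (λ v → length (filter (λ x → f x Fin.≟ v) xs))
length≤∑-fibres f [] = z≤n
length≤∑-fibres {n = n} f (x ∷ xs) = begin
  1 + length xs
    ≤⟨ +-mono-≤ (≤-trans (≤-reflexive (sym (⟦⟧-yes (f x Fin.≟ f x) refl))) (∑-∈ (∈-allFin (f x)) (λ v → ⟦ f x Fin.≟ v ⟧))) (length≤∑-fibres f xs) ⟩
  ∑ (allFin n) (λ v → ⟦ f x Fin.≟ v ⟧) + ∑ (allFin n) (λ v → length (filter (λ x → f x Fin.≟ v) xs))
    ≡⟨ ∑-+ (allFin n) _ _ ⟨
  ∑ (allFin n) (λ v → ⟦ f x Fin.≟ v ⟧ + length (filter (λ x → f x Fin.≟ v) xs))
    ≤⟨ ∑-mono (allFin n) (λ v → ≤-reflexive (sym (length-filter-∷ (λ x → f x Fin.≟ v) x xs))) ⟩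
  ∑ (allFin n) (λ v → length (filter (λ x → f x Fin.≟ v) (x ∷ xs))) ∎
  where open ≤-Reasoning

module _ (_≟_ : DecidableEquality I) where

  count : List I → I → ℕ
  count zs i = ∑ zs (λ z → ⟦ i ≟ z ⟧)

  count-∈ : ∀ {zs i} → i ∈ zs → 1 ≤ count zs i
  count-∈ {i = i} i∈zs = ≤-trans (≤-reflexive (sym (⟦⟧-yes (i ≟ i) refl))) (∑-∈ i∈zs _)

  count-∉ : ∀ {zs i} → i ∉ zs → count zs i ≡ 0
  count-∉ {[]}     i∉zs = refl
  count-∉ {z ∷ zs} {i} i∉zs = cong₂ _+_ (⟦⟧-no (i ≟ z) (i∉zs ∘ here)) (count-∉ (i∉zs ∘ there))

  count-unique : ∀ {zs} → Unique zs → ∀ i → count zs i ≤ 1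
  count-unique [] i = z≤n
  count-unique {z ∷ zs} (z∉zs ∷ zs!) i with i ≟ z
  ... | yes refl = ≤-reflexive (cong suc (count-∉ (λ i∈zs → All.lookup z∉zs i∈zs refl)))
  ... | no  _    = count-unique zs! i

  ⟦≟⟧-sym : ∀ i j → ⟦ i ≟ j ⟧ ≡ ⟦ j ≟ i ⟧
  ⟦≟⟧-sym i j with i ≟ j
  ... | yes i≡j = sym (⟦⟧-yes (j ≟ i) (sym i≡j))
  ... | no  i≢j = sym (⟦⟧-no (j ≟ i) (i≢j ∘ sym))

  ∑-count : ∀ is js → ∑ is (count js) ≡ ∑ js (count is)
  ∑-count is js = trans (∑-swap is js (λ i z → ⟦ i ≟ z ⟧)) (∑-cong js (λ j → ∑-cong is (λ i → ⟦≟⟧-sym i j)))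

  ∑-count≤ : ∀ {is} → Unique is → ∀ zs → ∑ is (count zs) ≤ length zs
  ∑-count≤ {is} is! zs = begin
    ∑ is (count zs)   ≡⟨ ∑-count is zs ⟩
    ∑ zs (count is)   ≤⟨ ∑-mono zs (count-unique is!) ⟩
    ∑ zs (λ _ → 1)    ≡⟨ ∑-const zs 1 ⟩
    length zs * 1     ≡⟨ *-identityʳ _ ⟩
    length zs         ∎
    where open ≤-Reasoning

  -- Pointwise `f i + count zs i * c ≤ c`: on `zs` the first summand vanishes, elsewhere the second.
  -- Summing over `is` gives the claim, stated as a sum to avoid truncated subtraction.
  ∑-vanishing : ∀ {is zs} → Unique zs → (∀ i → i ∈ is) → ∀ {f c} → (∀ {i} → i ∈ zs → f i ≡ 0) → (∀ i → f i ≤ c) →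
    ∑ is f + length zs * c ≤ length is * c
  ∑-vanishing {is} {zs} zs! all∈ {f} {c} f≡0 f≤c = begin
    ∑ is f + length zs * c
      ≤⟨ +-monoʳ-≤ (∑ is f) (*-monoˡ-≤ c length≤) ⟩
    ∑ is f + ∑ is (count zs) * c
      ≡⟨ cong (∑ is f +_) (∑-*ʳ is (count zs) c) ⟨
    ∑ is f + ∑ is (λ i → count zs i * c)
      ≡⟨ ∑-+ is f _ ⟨
    ∑ is (λ i → f i + count zs i * c)
      ≤⟨ ∑-mono is pointwise ⟩
    ∑ is (λ _ → c)
      ≡⟨ ∑-const is c ⟩
    length is * c ∎
    where
    open ≤-Reasoning
    open DecMembership _≟_ using (_∈?_)
    pointwise : ∀ i → f i + count zs i * c ≤ c
    pointwise i with i ∈? zs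
    ... | yes i∈zs = ≤-trans (≤-reflexive (cong (_+ count zs i * c) (f≡0 i∈zs))) (≤-trans (*-monoˡ-≤ c (count-unique zs! i)) (≤-reflexive (*-identityˡ c)))
    ... | no  i∉zs = ≤-trans (≤-reflexive (trans (cong (λ k → f i + k * c) (count-∉ i∉zs)) (+-identityʳ (f i)))) (f≤c i)
    length≤ : length zs ≤ ∑ is (count zs)
    length≤ = begin
      length zs       ≡⟨ *-identityʳ _ ⟨
      length zs * 1   ≡⟨ ∑-const zs 1 ⟨
      ∑ zs (λ _ → 1)  ≤⟨ ∑-mono zs (λ z → count-∈ (all∈ z)) ⟩
      ∑ zs (count is) ≡⟨ ∑-count is zs ⟨
      ∑ is (count zs) ∎

length-⊆ : ∀ {xs ys : List I} → Unique xs → (∀ {x} → x ∈ xs → x ∈ ys) → length xs ≤ length ys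
length-⊆ [] _ = z≤n
length-⊆ {xs = x ∷ xs} {ys} (x∉xs ∷ xs!) xs⊆ys with ∈-∃++ (xs⊆ys (here refl))
... | as , bs , refl = begin
  suc (length xs)               ≤⟨ s≤s (length-⊆ xs! xs⊆as++bs) ⟩
  suc (length (as ++ bs))       ≡⟨ cong suc (length-++ as) ⟩
  suc (length as + length bs)   ≡⟨ +-suc (length as) (length bs) ⟨
  length as + suc (length bs)   ≡⟨ length-++ as ⟨
  length (as ++ x ∷ bs)         ∎
  where
  open ≤-Reasoning
  xs⊆as++bs : ∀ {y} → y ∈ xs → y ∈ as ++ bs
  xs⊆as++bs y∈xs with ∈-++⁻ as (xs⊆ys (there y∈xs))
  ... | inj₁ y∈as          = ∈-++⁺ˡ y∈as
  ... | inj₂ (here refl)   = ⊥-elim (All.lookup x∉xs y∈xs refl)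
  ... | inj₂ (there y∈bs) = ∈-++⁺ʳ as y∈bs

length-filter-¬ : ∀ {A : Set} {P : A → Set} (P? : ∀ x → Dec (P x)) xs →
  length (filter P? xs) + length (filter (λ x → ¬? (P? x)) xs) ≡ length xs
length-filter-¬ P? [] = refl
length-filter-¬ P? (x ∷ xs) with P? x
... | yes _ = cong suc (length-filter-¬ P? xs)
... | no  _ = trans (+-suc _ _) (cong suc (length-filter-¬ P? xs))

-- Conditional probabilities

Edge : ℕ → Set
Edge n = Letter × Fin n

Partial : ℕ → Set
Partial n = List (Edge n × Fin n)

keys : Partial n → List (Edge n)
keys = map proj₁

δᵉ : Automaton n → Edge n → Fin n
δᵉ A (c , s) = δ A c s

infix 4 _⊨_
_⊨_ : Automaton n → Partial n → Set
A ⊨ σ = All (λ (e , v) → δᵉ A e ≡ v) σ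

update : Edge n → Fin n → Automaton n → Automaton n
update (a , s) v (ta , tb) = ta [ s ]≔ v , tb
update (b , s) v (ta , tb) = ta , tb [ s ]≔ v

δ-update : ∀ e (v : Fin n) A → δᵉ (update e v A) e ≡ v
δ-update (a , s) v (ta , tb) = lookup∘update s ta v
δ-update (b , s) v (ta , tb) = lookup∘update s tb v

δ-update′ : ∀ {e e' : Edge n} → e' ≢ e → ∀ v A → δᵉ (update e v A) e' ≡ δᵉ A e'
δ-update′ {e = a , s} {a , s'} e'≢e v (ta , tb) = lookup∘update′ (e'≢e ∘ cong (a ,_)) ta v
δ-update′ {e = a , s} {b , s'} e'≢e v (ta , tb) = refl
δ-update′ {e = b , s} {a , s'} e'≢e v (ta , tb) = refl
δ-update′ {e = b , s} {b , s'} e'≢e v (ta , tb) = lookup∘update′ (e'≢e ∘ cong (b ,_)) tb v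

update-update : ∀ e {v : Fin n} w A → δᵉ A e ≡ v → update e v (update e w A) ≡ A
update-update (a , s) w (ta , tb) refl = cong (_, tb) (trans ([]≔-idempotent ta s) ([]≔-lookup ta s))
update-update (b , s) w (ta , tb) refl = cong (ta ,_) (trans ([]≔-idempotent tb s) ([]≔-lookup tb s))

-- Rewriting the first prescribed value in all `n` ways turns `xs` into `n` disjoint lists of the
-- same length that still satisfy the remaining prescriptions. Restoring the old value undoes a
-- rewriting, so no repetitions arise.
length-⊨ : ∀ (σ : Partial n) → Unique (keys σ) → ∀ xs → Unique xs → All (_⊨ σ) xs →
  n ^ length σ * length xs ≤ n ^ (2 * n)
length-⊨ {n} [] _ xs xs! _ = begin
  1 * length xs            ≡⟨ *-identityˡ _ ⟩
  length xs                ≤⟨ length-⊆ xs! (λ {A} _ → ∈-automata A) ⟩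
  length (automata n)      ≡⟨ length-automata n ⟩
  n ^ (2 * n)              ∎
  where open ≤-Reasoning
length-⊨ {n} ((e , v) ∷ σ) (e∉σ ∷ σ!) xs xs! xs⊨ = begin
  n * n ^ length σ * length xs      ≡⟨ cong (_* length xs) (*-comm n _) ⟩
  n ^ length σ * n * length xs      ≡⟨ *-assoc (n ^ length σ) n _ ⟩
  n ^ length σ * (n * length xs)    ≡⟨ cong (n ^ length σ *_) length-ys ⟨
  n ^ length σ * length ys          ≤⟨ length-⊨ σ σ! ys ys! ys⊨ ⟩
  n ^ (2 * n)                       ∎
  where
  open ≤-Reasoning
  yss : List (List (Automaton n))
  yss = map (λ w → map (update e w) xs) (allFin n)
  ys : List (Automaton n)
  ys = concat yss
  length-ys : length ys ≡ n * length xs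
  length-ys = trans (length-concat (allFin n)) (cong (_* length xs) (length-tabulate {n = n} id))
    where
    length-concat : ∀ ws → length (concat (map (λ w → map (update e w) xs) ws)) ≡ length ws * length xs
    length-concat []       = refl
    length-concat (w ∷ ws) = trans (length-++ (map (update e w) xs)) (cong₂ _+_ (length-map (update e w) xs) (length-concat ws))
  ys! : Unique ys
  ys! = Unique.concat⁺ (All.map⁺ (All.universal (λ w → Unique.map⁻ (subst Unique (sym (map-retract w xs xs⊨)) xs!)) (allFin n)))
                       (AllPairs.map⁺ (AllPairs.map disjoint (Unique.allFin⁺ n)))
    where
    map-retract : ∀ w xs → All (_⊨ (e , v) ∷ σ) xs → map (update e v) (map (update e w) xs) ≡ xs
    map-retract w []       []              = refl
    map-retract w (A ∷ xs) ((p ∷ _) ∷ xs⊨) = cong₂ _∷_ (update-update e w A p) (map-retract w xs xs⊨)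
    disjoint : ∀ {w w'} → w ≢ w' → ∀ {A} → (A ∈ map (update e w) xs × A ∈ map (update e w') xs) → ⊥
    disjoint {w} {w'} w≢w' (p , q) with ∈-map⁻ (update e w) p | ∈-map⁻ (update e w') q
    ... | A , _ , refl | B , _ , eq = w≢w' (trans (sym (δ-update e w A)) (trans (cong (λ A → δᵉ A e) eq) (δ-update e w' B)))
  ys⊨ : All (_⊨ σ) ys
  ys⊨ = All.concat⁺ (All.map⁺ (All.universal (λ w → All.map⁺ (All.map (λ { {A} (_ ∷ A⊨σ) → keep w A e∉σ A⊨σ }) xs⊨)) (allFin n)))
    where
    keep : ∀ w A {τ} → All (e ≢_) (keys τ) → A ⊨ τ → update e w A ⊨ τ
    keep w A {[]}    _           []        = []
    keep w A {_ ∷ _} (e≢ ∷ e∉τ) (p ∷ A⊨τ) = trans (δ-update′ (e≢ ∘ sym) w A) p ∷ keep w A e∉τ A⊨τ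

module _ {n : ℕ} where

  -- P(Q | σ) ≤ N / D. Counting arbitrary lists without repetitions, instead of filtering the list of all
  -- automata, spares a decision procedure for Q.
  record Bnd (σ : Partial n) (Q : Automaton n → Set) (N D : ℕ) : Set where
    constructor mkBnd
    field
      bound : ∀ xs → Unique xs → All (λ A → A ⊨ σ × Q A) xs →
        D * (n ^ length σ * length xs) ≤ N * n ^ (2 * n)
  open Bnd

  private variable
    σ : Partial n
    P Q R : Automaton n → Set
    N D : ℕ

  bnd-top : Unique (keys σ) → Bnd σ Q D D
  bnd-top {σ = σ} {D = D} σ! = mkBnd λ xs xs! xs⊨ → *-monoʳ-≤ D (length-⊨ σ σ! xs xs! (All.map proj₁ xs⊨))

  bnd-absurd : (∀ {A} → A ⊨ σ → ¬ Q A) → Bnd σ Q N D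
  bnd-absurd {σ = σ} {D = D} ¬Q = mkBnd λ where
    []      _ _ → ≤-trans (≤-reflexive (trans (cong (D *_) (*-zeroʳ (n ^ length σ))) (*-zeroʳ D))) z≤n
    (A ∷ _) _ ((A⊨σ , q) ∷ _) → contradiction q (¬Q A⊨σ)

  bnd-weaken : (∀ {A} → A ⊨ σ → Q A → R A) → Bnd σ R N D → Bnd σ Q N D
  bnd-weaken Q⇒R B = mkBnd λ xs xs! xs⊨ → bound B xs xs! (All.map (λ (A⊨σ , q) → A⊨σ , Q⇒R A⊨σ q) xs⊨)

  bnd-≤ : ∀ {N D N' D'} .{{_ : NonZero D}} → N * D' ≤ N' * D → Bnd σ Q N D → Bnd σ Q N' D'
  bnd-≤ {σ = σ} {N = N} {D} {N'} {D'} ND'≤N'D B = mkBnd λ xs xs! xs⊨ → let X = n ^ length σ * length xs in *-cancelˡ-≤ D (begin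
    D * (D' * X)     ≡⟨ lemma₁ D D' X ⟩
    D' * (D * X)     ≤⟨ *-monoʳ-≤ D' (bound B xs xs! xs⊨) ⟩
    D' * (N * Y)     ≡⟨ lemma₂ D' N Y ⟩
    (N * D') * Y     ≤⟨ *-monoˡ-≤ Y ND'≤N'D ⟩
    (N' * D) * Y     ≡⟨ lemma₃ N' D Y ⟩
    D * (N' * Y)     ∎)
    where
    open ≤-Reasoning
    Y = n ^ (2 * n)
    lemma₁ : ∀ a b c → a * (b * c) ≡ b * (a * c)
    lemma₁ = solve-∀
    lemma₂ : ∀ a b c → a * (b * c) ≡ (b * a) * c
    lemma₂ = solve-∀
    lemma₃ : ∀ a b c → (a * b) * c ≡ b * (a * c)
    lemma₃ = solve-∀

  -- Law of total probability over the value at `e`. A fibre satisfies one more prescription, which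
  -- supplies the factor `n` of the denominator.
  bnd-reveal : ∀ {N : Fin n → ℕ} e → (∀ v → Bnd ((e , v) ∷ σ) Q (N v) D) → Bnd σ Q (∑ (allFin n) N) (D * n)
  bnd-reveal {σ = σ} {Q = Q} {D = D} {N} e B = mkBnd go
    where
    go : ∀ xs → Unique xs → All (λ A → A ⊨ σ × Q A) xs → D * n * (n ^ length σ * length xs) ≤ ∑ (allFin n) N * n ^ (2 * n)
    go xs xs! xs⊨ = begin
      D * n * (n ^ length σ * length xs)
        ≡⟨ lemma D n (n ^ length σ) (length xs) ⟩
      D * (n * n ^ length σ) * length xs
        ≤⟨ *-monoʳ-≤ (D * (n * n ^ length σ)) (length≤∑-fibres (λ A → δᵉ A e) xs) ⟩
      D * (n * n ^ length σ) * ∑ (allFin n) (λ v → length (fibre v))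
        ≡⟨ ∑-*ˡ (allFin n) (D * (n * n ^ length σ)) _ ⟨
      ∑ (allFin n) (λ v → D * (n * n ^ length σ) * length (fibre v))
        ≤⟨ ∑-mono (allFin n) (λ v → ≤-trans (≤-reflexive (*-assoc D _ _)) (bound (B v) (fibre v) (Unique.filter⁺ _ xs!) (fibre⊨ v))) ⟩
      ∑ (allFin n) (λ v → N v * n ^ (2 * n))
        ≡⟨ ∑-*ʳ (allFin n) N _ ⟩
      ∑ (allFin n) N * n ^ (2 * n) ∎
      where
      open ≤-Reasoning
      fibre : Fin n → List (Automaton n)
      fibre v = filter (λ A → δᵉ A e Fin.≟ v) xs
      fibre⊨ : ∀ v → All (λ A → A ⊨ ((e , v) ∷ σ) × _) (fibre v)
      fibre⊨ v = All.tabulate λ A∈ → let A∈xs , eq = ∈-filter⁻ (λ A → δᵉ A e Fin.≟ v) {xs = xs} A∈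
                                         A⊨σ , q = All.lookup xs⊨ A∈xs in (eq ∷ A⊨σ) , q
      lemma : ∀ d n m l → d * n * (m * l) ≡ d * (n * m) * l
      lemma = solve-∀

  -- For each list the bound is a decidable inequality. Hence a classical case distinction, such as
  -- whether an automaton with some property exists, may be used to prove it.
  bnd-stable : ¬ ¬ Bnd σ Q N D → Bnd σ Q N D
  bnd-stable ¬¬B = mkBnd λ xs xs! xs⊨ → decidable-stable (_ ≤? _) (λ ¬≤ → ¬¬B (λ B → ¬≤ (bound B xs xs! xs⊨)))

  bnd-⊎ : ∀ {N₁ N₂} → (∀ {A} → Q A → P A ⊎ R A) → Bnd σ P N₁ D → Bnd σ R N₂ D → Bnd σ Q (N₁ + N₂) D
  bnd-⊎ {Q = Q} {P} {R} {σ = σ} {D = D} {N₁} {N₂} Q⇒ B₁ B₂ = mkBnd go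
    where
    open ≤-Reasoning
    split : ∀ xs → Unique xs → All (λ A → A ⊨ σ × Q A) xs →
      ∃₂ λ ys zs → length xs ≡ length ys + length zs × (Unique ys × (∀ {A} → A ∈ ys → A ∈ xs) × All (λ A → A ⊨ σ × P A) ys)
                                                     × (Unique zs × (∀ {A} → A ∈ zs → A ∈ xs) × All (λ A → A ⊨ σ × R A) zs)
    split [] _ _ = [] , [] , refl , ([] , (λ ()) , []) , ([] , (λ ()) , [])
    split (A ∷ xs) (A∉xs ∷ xs!) ((A⊨σ , q) ∷ xs⊨) with split xs xs! xs⊨ | Q⇒ q
    ... | ys , zs , eq , (ys! , ys⊆ , ysP) , (zs! , zs⊆ , zsR) | inj₁ p =
      A ∷ ys , zs , cong suc eq , (All.tabulate (λ B∈ → All.lookup A∉xs (ys⊆ B∈)) ∷ ys! , (λ { (here r) → here r ; (there t) → there (ys⊆ t) }) , (A⊨σ , p) ∷ ysP)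
      , (zs! , (λ B∈ → there (zs⊆ B∈)) , zsR)
    ... | ys , zs , eq , (ys! , ys⊆ , ysP) , (zs! , zs⊆ , zsR) | inj₂ r =
      ys , A ∷ zs , trans (cong suc eq) (sym (+-suc _ _)) , (ys! , (λ B∈ → there (ys⊆ B∈)) , ysP)
      , (All.tabulate (λ B∈ → All.lookup A∉xs (zs⊆ B∈)) ∷ zs! , (λ { (here r) → here r ; (there t) → there (zs⊆ t) }) , (A⊨σ , r) ∷ zsR)
    go : ∀ xs → Unique xs → All (λ A → A ⊨ σ × Q A) xs → D * (n ^ length σ * length xs) ≤ (N₁ + N₂) * n ^ (2 * n)
    go xs xs! xs⊨ with split xs xs! xs⊨
    ... | ys , zs , eq , (ys! , _ , ysP) , (zs! , _ , zsR) = begin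
      D * (n ^ length σ * length xs)                 ≡⟨ cong (λ l → D * (n ^ length σ * l)) eq ⟩
      D * (n ^ length σ * (length ys + length zs))   ≡⟨ lemma D (n ^ length σ) (length ys) (length zs) ⟩
      D * (n ^ length σ * length ys) + D * (n ^ length σ * length zs)  ≤⟨ +-mono-≤ (bound B₁ ys ys! ysP) (bound B₂ zs zs! zsR) ⟩
      N₁ * n ^ (2 * n) + N₂ * n ^ (2 * n)            ≡⟨ *-distribʳ-+ (n ^ (2 * n)) N₁ N₂ ⟨
      (N₁ + N₂) * n ^ (2 * n) ∎
      where
      lemma : ∀ d m k l → d * (m * (k + l)) ≡ d * (m * k) + d * (m * l)
      lemma = solve-∀

  -- Bounds are stable, so excluded middle may be used for the finitely many automata concerned.
  bnd-cases : ∀ {N₁ N₂} → Bnd σ (λ A → Q A × P A) N₁ D → Bnd σ (λ A → Q A × ¬ P A) N₂ D → Bnd σ Q (N₁ + N₂) D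
  bnd-cases {σ = σ} {Q = Q} {P = P} {D = D} {N₁} {N₂} B₁ B₂ = mkBnd λ xs xs! xs⊨ → decidable-stable (_ ≤? _) λ ¬≤ → dec-all xs λ decs →
    ¬≤ (bound (bnd-⊎ {Q = λ A → A ∈ xs × Q A} {P = λ A → Q A × P A} {R = λ A → Q A × ¬ P A}
          (λ (A∈xs , q) → cases q (All.lookup decs A∈xs)) B₁ B₂) xs xs! (All.tabulate (λ A∈ → let A⊨σ , q = All.lookup xs⊨ A∈ in A⊨σ , A∈ , q)))
    where
    dec-all : ∀ xs → ¬ ¬ All (λ A → Dec (P A)) xs
    dec-all []       k = k []
    dec-all (A ∷ xs) k = ¬¬-excluded-middle λ d → dec-all xs λ ds → k (d ∷ ds)
    cases : ∀ {A} → Q A → Dec (P A) → (Q A × P A) ⊎ (Q A × ¬ P A)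
    cases q (yes p) = inj₁ (q , p)
    cases q (no ¬p) = inj₂ (q , ¬p)

  bnd-∃ : ∀ {Q : I → Automaton n → Set} is → (∀ i → Bnd σ (Q i) N D) → Bnd σ (λ A → ∃ λ i → i ∈ is × Q i A) (length is * N) D
  bnd-∃ []       B = bnd-absurd λ { _ (_ , () , _) }
  bnd-∃ {Q = Q} (i ∷ is) B = bnd-⊎ {P = Q i} (λ { (_ , here refl , q) → inj₁ q ; (j , there j∈ , q) → inj₂ (j , j∈ , q) }) (B i) (bnd-∃ is B)

-- Exploration with collisions

unique-↭ : ∀ {A : Set} {xs ys : List A} → xs ↭ ys → Unique xs → Unique ys
unique-↭ p = PermS.Unique-resp-↭ (setoid _) (↭⇒↭ₛ p)

-- Z collects the states met so far, and E consists of edges whose values are still to be revealed.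
record Inv (σ : Partial n) (Z : List (Fin n)) (E : List (Edge n)) : Set where
  constructor mkInv
  field
    unique : Unique (E ++ keys σ)
    seen   : All (λ e → proj₂ e ∈ Z) (E ++ keys σ)
open Inv

inv-↭ : ∀ {σ : Partial n} {Z E E'} → E ↭ E' → Inv σ Z E → Inv σ Z E'
inv-↭ {σ = σ} p (mkInv u s) = mkInv (unique-↭ (Perm.++⁺ʳ (keys σ) p) u) (Perm.All-resp-↭ (Perm.++⁺ʳ (keys σ) p) s)

inv-drop : ∀ {σ : Partial n} {Z e E} → Inv σ Z (e ∷ E) → Inv σ Z E
inv-drop (mkInv (_ ∷ u) (_ ∷ s)) = mkInv u s

inv-drop++ : ∀ {σ : Partial n} {Z} E {E'} → Inv σ Z (E ++ E') → Inv σ Z E'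
inv-drop++ []      i = i
inv-drop++ (e ∷ E) i = inv-drop++ E (inv-drop i)

inv-assign : ∀ {σ : Partial n} {Z e E} v → Inv σ Z (e ∷ E) → Inv ((e , v) ∷ σ) Z E
inv-assign {σ = σ} {e = e} {E} v (mkInv u s) = mkInv (unique-↭ p u) (Perm.All-resp-↭ p s)
  where p = ↭-sym (Perm.shift e E (keys σ))

inv-see : ∀ {σ : Partial n} {Z Z' E} → (∀ {z} → z ∈ Z → z ∈ Z') → Inv σ Z E → Inv σ Z' E
inv-see Z⊆Z' (mkInv u s) = mkInv u (All.map Z⊆Z' s)

-- Every edge revealed or pending leaves a state in `Z`, so both edges of a state outside `Z` are
-- new.
inv-open : ∀ {σ : Partial n} {Z E s} → s ∉ Z → Inv σ Z E → Inv σ (s ∷ Z) ((a , s) ∷ (b , s) ∷ E)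
inv-open {σ = σ} {E = E} {s = t} s∉Z (mkInv u s) = mkInv (((λ ()) ∷ fresh) ∷ fresh ∷ u) (here refl ∷ here refl ∷ All.map there s)
  where
  fresh : ∀ {c} → All ((c , t) ≢_) (E ++ keys σ)
  fresh = All.map (λ { s∈Z refl → s∉Z s∈Z }) s

inv-keys : ∀ {σ : Partial n} {Z E} → Inv σ Z E → Unique (keys σ)
inv-keys {E = []}    (mkInv u _)              = u
inv-keys {E = _ ∷ _} (mkInv (_ ∷ u) (_ ∷ s)) = inv-keys (mkInv u s)

module Error {n : ℕ} .{{_ : NonZero n}} (Q : Automaton n → Set) (N D : ℕ) .{{_ : NonZero D}} where

  open DecMembership (Fin._≟_ {n}) using (_∈?_)

  -- Probability at most N / D + α / n ^ j.
  record Err (σ : Partial n) (j α : ℕ) : Set where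
    constructor mkErr
    field
      err : Bnd σ Q (N * n ^ j + D * α) (D * n ^ j)
  open Err public

  private instance
    Dn≢0 : ∀ {j} → NonZero (D * n ^ j)
    Dn≢0 {j} = m*n≢0 D (n ^ j) {{it}} {{m^n≢0 n j}}

  err-≤ : ∀ {σ j α α'} → α ≤ α' → Err σ j α → Err σ j α'
  err-≤ {j = j} α≤α' (mkErr B) = mkErr (bnd-≤ {{Dn≢0 {j}}} (*-monoˡ-≤ (D * n ^ j) (+-monoʳ-≤ (N * n ^ j) (*-monoʳ-≤ D α≤α'))) B)

  err-bnd : ∀ {σ j α} → Bnd σ Q N D → Err σ j α
  err-bnd {j = j} {α} B = mkErr $ flip bnd-≤ B (begin
    N * (D * n ^ j)              ≡⟨ lemma N D (n ^ j) ⟩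
    N * n ^ j * D                ≤⟨ *-monoˡ-≤ D (m≤m+n (N * n ^ j) (D * α)) ⟩
    (N * n ^ j + D * α) * D      ∎)
    where
    open ≤-Reasoning
    lemma : ∀ a b c → a * (b * c) ≡ a * c * b
    lemma = solve-∀

  -- With no power of `n` left the error term is at least 1. This closes a branch whose allowance of
  -- collisions is used up.
  err-top : ∀ {σ α} → Unique (keys σ) → Err σ 0 (suc α)
  err-top {α = α} σ! = mkErr $ bnd-≤ (begin
    D * (D * 1)                   ≡⟨ cong (λ d → D * d) (*-identityʳ D) ⟩
    D * D                         ≤⟨ *-monoˡ-≤ D (≤-trans (m≤m*n D (suc α)) (m≤n+m (D * suc α) (N * 1))) ⟩
    (N * 1 + D * suc α) * D       ∎) (bnd-top σ!)
    where open ≤-Reasoning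

  err-small : ∀ {σ j α} → D * α ≤ n ^ j → Err σ j α → Bnd σ Q (suc N) D
  err-small {j = j} {α} Dα≤ (mkErr B) = flip (bnd-≤ {{Dn≢0 {j}}}) B (begin
    (N * n ^ j + D * α) * D       ≤⟨ *-monoˡ-≤ D (+-monoʳ-≤ (N * n ^ j) Dα≤) ⟩
    (N * n ^ j + n ^ j) * D       ≡⟨ lemma N (n ^ j) D ⟩
    suc N * (D * n ^ j)           ∎)
    where
    open ≤-Reasoning
    lemma : ∀ N k D → (N * k + k) * D ≡ suc N * (D * k)
    lemma = solve-∀

  -- A value in `Z` has probability at most `h / n` and thus contributes at most
  -- `h * β / n ^ suc j`. In `bound-at` the values in `Z` are charged the term `x` of the others as
  -- well, which makes the sum over all values immediate.
  err-branch : ∀ {σ} e Z {h j α β} → length Z ≤ h →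
    (∀ v → v ∈ Z → Err ((e , v) ∷ σ) j β) → (∀ v → v ∉ Z → Err ((e , v) ∷ σ) (suc j) α) →
    Err σ (suc j) (α + h * β)
  err-branch {σ} e Z {h} {j} {α} {β} |Z|≤h bad good =
    mkErr $ bnd-≤ {{m*n≢0 (D * n ^ suc j) n {{Dn≢0 {suc j}}}}} total (bnd-reveal {N = bound-at} e at)
    where
    open ≤-Reasoning
    x = N * n ^ suc j + D * α
    y = D * (n * β)
    bound-at : Fin n → ℕ
    bound-at v = x + count Fin._≟_ Z v * y
    at : ∀ v → Bnd ((e , v) ∷ σ) Q (bound-at v) (D * n ^ suc j)
    at v with v ∈? Z
    ... | no v∉Z = bnd-≤ {{Dn≢0 {suc j}}} (*-monoˡ-≤ (D * n ^ suc j) (m≤m+n x _)) (err (good v v∉Z))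
    ... | yes v∈Z = bnd-≤ {{Dn≢0 {j}}} (begin
      (N * n ^ j + D * β) * (D * (n * n ^ j))   ≡⟨ lemma N (n ^ j) D β n ⟩
      (N * (n * n ^ j) + y) * (D * n ^ j)       ≤⟨ *-monoˡ-≤ (D * n ^ j) (+-mono-≤ (m≤m+n (N * n ^ suc j) (D * α)) y≤) ⟩
      bound-at v * (D * n ^ j)                  ∎) (err (bad v v∈Z))
      where
      lemma : ∀ N k D β n → (N * k + D * β) * (D * (n * k)) ≡ (N * (n * k) + D * (n * β)) * (D * k)
      lemma = solve-∀
      y≤ : y ≤ count Fin._≟_ Z v * y
      y≤ = ≤-trans (≤-reflexive (sym (*-identityˡ y))) (*-monoˡ-≤ y (count-∈ Fin._≟_ v∈Z))
    total : ∑ (allFin n) bound-at * (D * n ^ suc j) ≤ (N * n ^ suc j + D * (α + h * β)) * (D * n ^ suc j * n)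
    total = begin
      ∑ (allFin n) bound-at * (D * n ^ suc j)
        ≡⟨ cong (_* (D * n ^ suc j)) (trans (∑-+ (allFin n) _ _) (cong₂ _+_ (trans (∑-const (allFin n) x) (cong (_* x) (length-tabulate {n = n} id))) (∑-*ʳ (allFin n) _ y))) ⟩
      (n * x + ∑ (allFin n) (count Fin._≟_ Z) * y) * (D * n ^ suc j)
        ≤⟨ *-monoˡ-≤ (D * n ^ suc j) (+-monoʳ-≤ (n * x) (*-monoˡ-≤ y (≤-trans (∑-count≤ Fin._≟_ (Unique.allFin⁺ n) Z) |Z|≤h))) ⟩
      (n * x + h * y) * (D * n ^ suc j)
        ≡⟨ lemma N (n ^ suc j) D α β n h ⟩
      (N * n ^ suc j + D * (α + h * β)) * (D * n ^ suc j * n) ∎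
      where
      lemma : ∀ N k D α β n h → (n * (N * k + D * α) + h * (D * (n * β))) * (D * k) ≡ (N * k + D * (α + h * β)) * (D * k * n)
      lemma = solve-∀

-- ψ h q j / n ^ j bounds the probability that, of q pairs of revealed values, j contain one in a set of h states.
ψ : ℕ → ℕ → ℕ → ℕ
ψ h q       zero    = 1
ψ h zero    (suc j) = 0
ψ h (suc q) (suc j) = ψ h q (suc j) + h * ψ h q j + h * ψ h q j

ψ-mono : ∀ h {q q'} j → q ≤ q' → ψ h q j ≤ ψ h q' j
ψ-mono h zero    _         = ≤-refl
ψ-mono h (suc j) z≤n       = z≤n
ψ-mono h (suc j) (s≤s q≤q') = +-mono-≤ (+-mono-≤ (ψ-mono h (suc j) q≤q') (*-monoʳ-≤ h (ψ-mono h j q≤q'))) (*-monoʳ-≤ h (ψ-mono h j q≤q'))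

-- The number of tasks processed in d levels starting with at most U tasks.
work : ℕ → ℕ → ℕ
work zero    U = 0
work (suc d) U = U + work d (2 * U)

-- A pair of states reached by reading the word, together with the letter to be read next.
record Task (n : ℕ) : Set where
  constructor task
  field
    word   : Word
    letter : Letter
    left   : Fin n
    right  : Fin n
open Task public

edges : Task n → List (Edge n)
edges t = (letter t , left t) ∷ (letter t , right t) ∷ []

flat : List (Task n) → List (Edge n)
flat = concatMap edges

children : Word → Letter → Fin n → Fin n → List (Task n)
children w c u v = task (w ++ [ c ]) a u v ∷ task (w ++ [ c ]) b u v ∷ []

δ*-∷ʳ : ∀ (A : Automaton n) w c x → δ* A (w ++ [ c ]) x ≡ δ A c (δ* A w x)
δ*-∷ʳ A w c x = foldl-++ _ x w [ c ]

length-∷ʳ : ∀ w (c : Letter) → length (w ++ [ c ]) ≡ suc (length w)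
length-∷ʳ w c = trans (length-++ w) (+-comm (length w) 1)

-- The left components start in `X` and the right ones in `Y`. The edges in `R` are reserved: they
-- stay unrevealed throughout.
module Exploration {n : ℕ} .{{_ : NonZero n}} (X Y : List (Fin n)) (R : List (Edge n)) where

  record Valid (σ : Partial n) (ℓ : ℕ) (t : Task n) : Set where
    constructor valid
    field
      {x y}  : Fin n
      short  : length (word t) ≤ ℓ
      x∈X    : x ∈ X
      y∈Y    : y ∈ Y
      path   : ∀ {A} → A ⊨ σ → δ* A (word t) x ≡ left t × δ* A (word t) y ≡ right t

  valid-∷ : ∀ {σ ℓ t kv} → Valid σ ℓ t → Valid (kv ∷ σ) ℓ t
  valid-∷ (valid s x∈X y∈Y p) = valid s x∈X y∈Y λ { (_ ∷ A⊨σ) → p A⊨σ }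

  valid-∷∷ : ∀ {σ ℓ t kv kv'} → Valid σ ℓ t → Valid (kv ∷ kv' ∷ σ) ℓ t
  valid-∷∷ = valid-∷ ∘ valid-∷

  valid-children : ∀ {σ ℓ w c u v u' v'} → Valid σ ℓ (task w c u v) →
    All (Valid (((c , v) , v') ∷ ((c , u) , u') ∷ σ) (suc ℓ)) (children w c u' v')
  valid-children {σ} {ℓ} {w} {c} {u} {v} {u'} {v'} (valid {x} {y} s x∈X y∈Y p) = child ∷ child ∷ []
    where
    child : ∀ {d} → Valid (((c , v) , v') ∷ ((c , u) , u') ∷ σ) (suc ℓ) (task (w ++ [ c ]) d u' v')
    child = valid (≤-trans (≤-reflexive (length-∷ʳ w c)) (s≤s s)) x∈X y∈Y λ { {A} (ev ∷ eu ∷ A⊨σ) →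
      trans (δ*-∷ʳ A w c x) (trans (cong (δ A c) (proj₁ (p A⊨σ))) eu) ,
      trans (δ*-∷ʳ A w c y) (trans (cong (δ A c) (proj₂ (p A⊨σ))) ev) }

  record Conf (ℓ : ℕ) (σ : Partial n) (Z : List (Fin n)) (ts : List (Task n)) : Set where
    constructor conf
    field
      inv    : Inv σ Z (flat ts ++ R)
      valids : All (Valid σ ℓ) ts

  inv-children : ∀ {σ : Partial n} {Z} w c {u v E} → u ∉ Z → v ∉ u ∷ Z → Inv σ Z E → Inv σ (v ∷ u ∷ Z) (flat (children w c u v) ++ E)
  inv-children w c {u} {v} {E} u∉Z v∉Z i = inv-↭ p (inv-open v∉Z (inv-open u∉Z i))
    where
    p : (a , v) ∷ (b , v) ∷ (a , u) ∷ (b , u) ∷ E ↭ (a , u) ∷ (a , v) ∷ (b , u) ∷ (b , v) ∷ E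
    p = ↭-trans (Perm.shift (a , u) ((a , v) ∷ (b , v) ∷ []) ((b , u) ∷ E))
                (prep (a , u) (prep (a , v) (Perm.shift (b , u) ((b , v) ∷ []) E)))

  module _ (Q : Automaton n → Set) (N D : ℕ) .{{_ : NonZero D}} (h : ℕ) where

    open Error Q N D

    -- The collision with number `suc k` exhausts the allowance, and `i` counts the collisions on
    -- this level. A task without collision contributes two children, a task with one contributes
    -- none, whence the balance in the continuation. The two reveals of a task match the two terms
    -- with factor `h` in the recursion of `ψ`, and `q` tasks are set aside for later levels.
    level : ∀ ts {done σ Z ζ ℓ} k q →
      Inv σ Z (flat ts ++ flat done ++ R) → All (Valid σ ℓ) ts → All (Valid σ (suc ℓ)) done →
      length Z ≤ ζ → ζ + 2 * length ts ≤ h →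
      (∀ {σ' Z' done'} i k' → i + k' ≡ k → length done' + 2 * i ≡ 2 * length ts + length done →
        length Z' ≤ ζ + 2 * length ts → Conf (suc ℓ) σ' Z' done' → Err σ' (suc k') (ψ h q (suc k'))) →
      Err σ (suc k) (ψ h (length ts + q) (suc k))
    level [] {done} {ζ = ζ} k q inv vs ws |Z|≤ζ ζ≤h cont =
      cont 0 k refl (+-identityʳ (length done)) (≤-trans |Z|≤ζ (m≤m+n ζ 0)) (conf inv ws)
    level (task w c u v ∷ ts) {done} {σ} {Z} {ζ} {ℓ} k q inv (val ∷ vs) ws |Z|≤ζ ζ≤h cont =
      err-branch (c , u) Z (≤-trans |Z|≤ζ (≤-trans (m≤m+n ζ _) ζ≤h))
        -- The right edge is discarded without being revealed.
        (λ p p∈Z → kill k (inv-drop (inv-assign p inv)) (All.map valid-∷ vs) (All.map valid-∷ ws) (≤-trans |Z|≤ζ (n≤1+n ζ)) cont)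
        (λ p p∉Z → let inv' = inv-see {Z' = p ∷ Z} there (inv-assign p inv) in
          err-branch (c , v) (p ∷ Z) (≤-trans (s≤s |Z|≤ζ) 1+ζ≤h)
            (λ p' _ → kill k (inv-assign p' inv') (All.map valid-∷∷ vs) (All.map valid-∷∷ ws) (s≤s |Z|≤ζ) cont)
            (λ p' p'∉Z → level ts {children w c p p' ++ done} k q
              (inv-↭ (Perm.shifts (flat (children w c p p')) (flat ts))
                (inv-children w c p∉Z p'∉Z (inv-assign p' (inv-assign p inv))))
              (All.map valid-∷∷ vs) (All.++⁺ (valid-children val) (All.map valid-∷∷ ws))
              (s≤s (s≤s |Z|≤ζ)) 2+ζ≤h
              (λ i k' eq len |Z'|≤ → cont i k' eq (trans len (lemma₁ (length ts) (length done))) (≤-trans |Z'|≤ (≤-reflexive (lemma₂ ζ (length ts)))))))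
      where
      lemma₁ : ∀ t d → 2 * t + suc (suc d) ≡ 2 * suc t + d
      lemma₁ = solve-∀
      lemma₂ : ∀ ζ t → suc (suc ζ) + 2 * t ≡ ζ + 2 * suc t
      lemma₂ = solve-∀
      2+ζ≤h : suc (suc ζ) + 2 * length ts ≤ h
      2+ζ≤h = ≤-trans (≤-reflexive (lemma₂ ζ (length ts))) ζ≤h
      1+ζ≤h : suc ζ ≤ h
      1+ζ≤h = ≤-trans (n≤1+n (suc ζ)) (≤-trans (m≤m+n (suc (suc ζ)) _) 2+ζ≤h)
      -- If the right value collides, the left one has already joined the states seen, hence
      -- `suc ζ`.
      kill : ∀ {σ' Z'} k → Inv σ' Z' (flat ts ++ flat done ++ R) → All (Valid σ' ℓ) ts → All (Valid σ' (suc ℓ)) done →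
        length Z' ≤ suc ζ →
        (∀ {σ' Z' done'} i k' → i + k' ≡ k → length done' + 2 * i ≡ 2 * suc (length ts) + length done →
          length Z' ≤ ζ + 2 * suc (length ts) → Conf (suc ℓ) σ' Z' done' → Err σ' (suc k') (ψ h q (suc k'))) →
        Err σ' k (ψ h (length ts + q) k)
      kill zero    inv vs ws |Z'|≤ cont = err-top (inv-keys inv)
      kill (suc k) inv vs ws |Z'|≤ cont = level ts {done} k q inv vs ws |Z'|≤ (≤-trans (n≤1+n _) 2+ζ≤h)
        (λ {_} {_} {done'} i k' eq len |Z''|≤ → cont (suc i) k' (cong suc eq)
          (trans (lemma₃ (length done') i) (trans (cong (suc ∘ suc) len) (lemma₄ (length ts) (length done))))
          (≤-trans |Z''|≤ (≤-trans (n≤1+n _) (≤-reflexive (lemma₂ ζ (length ts))))))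
        where
        lemma₃ : ∀ d i → d + 2 * suc i ≡ suc (suc (d + 2 * i))
        lemma₃ = solve-∀
        lemma₄ : ∀ t d → suc (suc (2 * t + d)) ≡ 2 * suc t + d
        lemma₄ = solve-∀

    -- Invariant: at least `M + k` tasks while `k` collisions are affordable. If `i` of these occur
    -- on a level and `k'` are left, at least `2 * (M + k) - 2 * i = 2 * M + 2 * k'` tasks result,
    -- so the invariant holds again with `2 * M` and `k'`. After `d` levels at least `2 ^ d * M`
    -- tasks remain.
    explore : ∀ d {ts σ Z ζ ℓ} k M U → Conf ℓ σ Z ts → M + k ≤ length ts → length ts ≤ U →
      length Z ≤ ζ → ζ + 2 * work d U ≤ h →
      (∀ {σ' Z' ts'} → Conf (d + ℓ) σ' Z' ts' → 2 ^ d * M ≤ length ts' → length Z' ≤ ζ + 2 * work d U → Bnd σ' Q N D) →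
      Err σ (suc k) (ψ h (work d U) (suc k))
    explore zero {ζ = ζ} k M U c M+k≤ _ |Z|≤ζ _ cont =
      err-bnd (cont c (≤-trans (≤-reflexive (*-identityˡ M)) (≤-trans (m≤m+n M k) M+k≤)) (≤-trans |Z|≤ζ (m≤m+n ζ 0)))
    explore (suc d) {ts} {σ} {Z} {ζ} {ℓ} k M U (conf inv vs) M+k≤ ≤U |Z|≤ζ ≤h cont =
      err-≤ (ψ-mono h (suc k) (+-monoˡ-≤ (work d (2 * U)) ≤U))
        (level ts {[]} k (work d (2 * U)) inv vs [] |Z|≤ζ (≤-trans (+-monoʳ-≤ ζ (*-monoʳ-≤ 2 (≤-trans ≤U (m≤m+n U _)))) ≤h)
          λ {_} {_} {done'} i k' eq len |Z'|≤ c →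
            explore d k' (2 * M) (2 * U) c (enough {length done'} i k' eq len)
              (≤-trans (m≤m+n (length done') (2 * i)) (≤-trans (≤-reflexive (trans len (+-identityʳ _))) (*-monoʳ-≤ 2 ≤U)))
              (≤-trans |Z'|≤ (+-monoʳ-≤ ζ (*-monoʳ-≤ 2 ≤U)))
              (≤-trans (≤-reflexive (lemma₁ ζ U (work d (2 * U)))) ≤h)
              (λ {σ'} {Z'} {ts'} c' |ts'|≥ |Z'|≤' → cont (subst (λ ℓ → Conf ℓ σ' Z' ts') (+-suc d ℓ) c')
                (≤-trans (≤-reflexive (lemma₂ (2 ^ d) M)) |ts'|≥) (≤-trans |Z'|≤' (≤-reflexive (lemma₁ ζ U (work d (2 * U)))))))
      where
      open ≤-Reasoning
      lemma₁ : ∀ ζ U w → ζ + 2 * U + 2 * w ≡ ζ + 2 * (U + w)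
      lemma₁ = solve-∀
      lemma₂ : ∀ t M → 2 * t * M ≡ t * (2 * M)
      lemma₂ = solve-∀
      lemma₃ : ∀ M k' i → 2 * M + k' + 2 * i + k' ≡ 2 * (M + (i + k'))
      lemma₃ = solve-∀
      enough : ∀ {l} i k' → i + k' ≡ k → l + 2 * i ≡ 2 * length ts + 0 → 2 * M + k' ≤ l
      enough {l} i k' refl len = +-cancelʳ-≤ (2 * i) (2 * M + k') l (begin
        2 * M + k' + 2 * i         ≤⟨ m≤m+n _ k' ⟩
        2 * M + k' + 2 * i + k'    ≡⟨ lemma₃ M k' i ⟩
        2 * (M + (i + k'))         ≤⟨ *-monoʳ-≤ 2 M+k≤ ⟩
        2 * length ts              ≡⟨ +-identityʳ _ ⟨
        2 * length ts + 0          ≡⟨ len ⟨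
        l + 2 * i                  ∎)

-- Estimates for `ψ`

ψ≤^ : ∀ h q j → ψ h q j ≤ (2 * h * q) ^ j
ψ≤^ h q       zero    = ≤-refl
ψ≤^ h zero    (suc j) = z≤n
ψ≤^ h (suc q) (suc j) = begin
  ψ h q (suc j) + h * ψ h q j + h * ψ h q j
    ≤⟨ +-mono-≤ (+-mono-≤ (ψ≤^ h q (suc j)) (*-monoʳ-≤ h (ψ≤^ h q j))) (*-monoʳ-≤ h (ψ≤^ h q j)) ⟩
  2 * h * q * x + h * x + h * x
    ≡⟨ lemma h q x ⟩
  2 * h * suc q * x
    ≤⟨ *-monoʳ-≤ (2 * h * suc q) (^-monoˡ-≤ j (*-monoʳ-≤ (2 * h) (n≤1+n q))) ⟩
  2 * h * suc q * (2 * h * suc q) ^ j ∎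
  where
  open ≤-Reasoning
  x = (2 * h * q) ^ j
  lemma : ∀ h q x → 2 * h * q * x + h * x + h * x ≡ 2 * h * suc q * x
  lemma = solve-∀

-- In fact `ψ h q j` is the binomial coefficient of `q` over `j` times `(2 * h) ^ j`. Bounding the
-- coefficient by `q ^ j`, as in `ψ≤^`, suits a constant number of collisions; bounding it by
-- `2 ^ q` suits a number proportional to `q`.
ψ≤2^ : ∀ h q j → ψ h q j ≤ 2 ^ q * (2 * h) ^ j
ψ≤2^ h q       zero    = ≤-trans (m^n>0 2 q) (≤-reflexive (sym (*-identityʳ (2 ^ q))))
ψ≤2^ h zero    (suc j) = z≤n
ψ≤2^ h (suc q) (suc j) = begin
  ψ h q (suc j) + h * ψ h q j + h * ψ h q j
    ≤⟨ +-mono-≤ (+-mono-≤ (ψ≤2^ h q (suc j)) (*-monoʳ-≤ h (ψ≤2^ h q j))) (*-monoʳ-≤ h (ψ≤2^ h q j)) ⟩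
  2 ^ q * (2 * h * x) + h * (2 ^ q * x) + h * (2 ^ q * x)
    ≡⟨ lemma h (2 ^ q) x ⟩
  2 * 2 ^ q * (2 * h * x) ∎
  where
  open ≤-Reasoning
  x = (2 * h) ^ j
  lemma : ∀ h q x → q * (2 * h * x) + h * (q * x) + h * (q * x) ≡ 2 * q * (2 * h * x)
  lemma = solve-∀

^-distribʳ-* : ∀ x y k → (x * y) ^ k ≡ x ^ k * y ^ k
^-distribʳ-* x y zero    = refl
^-distribʳ-* x y (suc k) = trans (cong (x * y *_) (^-distribʳ-* x y k)) (lemma x y (x ^ k) (y ^ k))
  where
  lemma : ∀ a b c d → a * b * (c * d) ≡ a * c * (b * d)
  lemma = solve-∀

-- The factor `2 ^ q` is spread over the `suc M` collisions, at `2 ^ k` each, and another factor 2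
-- for each of them pays for `D`. Each collision then still costs at most `n`.
ψ-small : ∀ {n h D} k M q → q ≤ k * M → 4 * (2 ^ k * h) ≤ n → D ≤ 2 ^ suc M → D * ψ h q (suc M) ≤ n ^ suc M
ψ-small {n} {h} {D} k M q q≤ h≤ D≤ = begin
  D * ψ h q m
    ≤⟨ *-mono-≤ D≤ (≤-trans (ψ≤2^ h q m) (*-monoˡ-≤ ((2 * h) ^ m) (^-monoʳ-≤ 2 (≤-trans q≤ (*-monoʳ-≤ k (n≤1+n M)))))) ⟩
  2 ^ m * (2 ^ (k * m) * (2 * h) ^ m)
    ≡⟨ cong (λ x → 2 ^ m * (x * (2 * h) ^ m)) (^-*-assoc 2 k m) ⟨
  2 ^ m * ((2 ^ k) ^ m * (2 * h) ^ m)
    ≡⟨ cong (2 ^ m *_) (^-distribʳ-* (2 ^ k) (2 * h) m) ⟨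
  2 ^ m * (2 ^ k * (2 * h)) ^ m
    ≡⟨ ^-distribʳ-* 2 (2 ^ k * (2 * h)) m ⟨
  (2 * (2 ^ k * (2 * h))) ^ m
    ≡⟨ cong (_^ m) (lemma (2 ^ k) h) ⟩
  (4 * (2 ^ k * h)) ^ m
    ≤⟨ ^-monoˡ-≤ m h≤ ⟩
  n ^ m ∎
  where
  open ≤-Reasoning
  m = suc M
  lemma : ∀ x h → 2 * (x * (2 * h)) ≡ 4 * (x * h)
  lemma = solve-∀

flat-++ : ∀ (ts us : List (Task n)) → flat (ts ++ us) ≡ flat ts ++ flat us
flat-++ = List.concatMap-++ edges

-- Words and a pigeonhole principle for them

_≟ˡ_ : DecidableEquality Letter
a ≟ˡ a = yes refl
a ≟ˡ b = no λ ()
b ≟ˡ a = no λ ()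
b ≟ˡ b = yes refl

_≟ʷ_ : DecidableEquality Word
_≟ʷ_ = List.≡-dec _≟ˡ_

wordsUpTo : ℕ → List Word
wordsUpTo zero    = [ [] ]
wordsUpTo (suc ℓ) = [] ∷ map (a ∷_) (wordsUpTo ℓ) ++ map (b ∷_) (wordsUpTo ℓ)

∈-wordsUpTo : ∀ {ℓ} w → length w ≤ ℓ → w ∈ wordsUpTo ℓ
∈-wordsUpTo {zero}  []      _        = here refl
∈-wordsUpTo {suc ℓ} []      _        = here refl
∈-wordsUpTo {suc ℓ} (a ∷ w) (s≤s w≤) = there (∈-++⁺ˡ (∈-map⁺ (a ∷_) (∈-wordsUpTo w w≤)))
∈-wordsUpTo {suc ℓ} (b ∷ w) (s≤s w≤) = there (∈-++⁺ʳ _ (∈-map⁺ (b ∷_) (∈-wordsUpTo w w≤)))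

length-wordsUpTo : ∀ ℓ → suc (length (wordsUpTo ℓ)) ≡ 2 ^ suc ℓ
length-wordsUpTo zero    = refl
length-wordsUpTo (suc ℓ) = trans (cong (suc ∘ suc) (trans (length-++ (map (a ∷_) ws)) (cong₂ _+_ (length-map _ ws) (length-map _ ws))))
                                 (trans (lemma (length ws)) (cong (2 *_) (length-wordsUpTo ℓ)))
  where
  ws = wordsUpTo ℓ
  lemma : ∀ l → suc (suc (l + l)) ≡ 2 * suc l
  lemma = solve-∀

module Popular {H : Set} (key : H → Word) where

  class : List H → Word → List H
  class hs w = filter (λ t → key t ≟ʷ w) hs

  length-class-filter : ∀ {P : H → Set} (P? : ∀ t → Dec (P t)) hs w → length (class (filter P? hs) w) ≤ length (class hs w)
  length-class-filter P? []       w = z≤n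
  length-class-filter P? (t ∷ hs) w with P? t
  ... | yes _ = ≤-trans (≤-reflexive (length-filter-∷ (λ t → key t ≟ʷ w) t (filter P? hs)))
                  (≤-trans (+-monoʳ-≤ _ (length-class-filter P? hs w)) (≤-reflexive (sym (length-filter-∷ (λ t → key t ≟ʷ w) t hs))))
  ... | no  _ = ≤-trans (length-class-filter P? hs w) (≤-trans (m≤n+m _ ⟦ key t ≟ʷ w ⟧) (≤-reflexive (sym (length-filter-∷ (λ t → key t ≟ʷ w) t hs))))

  length≤classes : ∀ ws {hs θ} → All (λ t → key t ∈ ws) hs → (∀ w → length (class hs w) ≤ θ) → length hs ≤ length ws * θ
  length≤classes []       {[]}    _         _  = z≤n
  length≤classes []       {_ ∷ _} (() ∷ _) _
  length≤classes (w ∷ ws) {hs} all∈ ≤θ = ≤-trans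
    (≤-reflexive (sym (length-filter-¬ (λ t → key t ≟ʷ w) hs)))
    (+-mono-≤ (≤θ w) (length≤classes ws
      (All.tabulate λ t∈ → let t∈hs , ≢w = ∈-filter⁻ (λ t → ¬? (key t ≟ʷ w)) t∈ in tail (All.lookup all∈ t∈hs) ≢w)
      (λ w' → ≤-trans (length-class-filter (λ t → ¬? (key t ≟ʷ w)) hs w') (≤θ w'))))
    where
    tail : ∀ {v} → v ∈ w ∷ ws → v ≢ w → v ∈ ws
    tail (here v≡w) v≢w = contradiction v≡w v≢w
    tail (there v∈) _   = v∈

  popular? : ∀ θ (hs : List H) t → Dec (θ ≤ length (class hs (key t)))
  popular? θ hs t = θ ≤? length (class hs (key t))

  popular : ℕ → List H → List H
  popular θ hs = filter (popular? θ hs) hs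

  -- At most `θ` unpopular elements share a word: if there is one at all, its whole class has fewer
  -- than `θ` elements.
  length-popular : ∀ θ ws hs → All (λ t → key t ∈ ws) hs → length hs ≤ length (popular θ hs) + length ws * θ
  length-popular θ ws hs all∈ = ≤-trans
    (≤-reflexive (sym (length-filter-¬ (popular? θ hs) hs)))
    (+-monoʳ-≤ (length (popular θ hs)) (length≤classes ws
      (All.tabulate λ t∈ → All.lookup all∈ (proj₁ (∈-filter⁻ (λ t → ¬? (popular? θ hs t)) t∈))) rare))
    where
    others = filter (λ t → ¬? (popular? θ hs t)) hs
    rare : ∀ w → length (class others w) ≤ θ
    rare w with class others w in eq
    ... | []    = z≤n
    ... | t ∷ _ with ∈-filter⁻ (λ t → key t ≟ʷ w) {xs = others} (subst (t ∈_) (sym eq) (here refl))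
    ...   | t∈ , refl = ≤-trans (≤-reflexive (cong length (sym eq)))
      (≤-trans (length-class-filter (λ t → ¬? (popular? θ hs t)) hs w)
        (<⇒≤ (≰⇒> (proj₂ (∈-filter⁻ (λ t → ¬? (popular? θ hs t)) {xs = hs} t∈)))))

-- Exponential growth of the branches

module Growth {n : ℕ} .{{_ : NonZero n}} (X Y : List (Fin n)) (R : List (Edge n)) where

  open Exploration X Y R

  -- Surplus tasks are given up so that a stage can begin with an exact number of them.
  conf-take : ∀ {ℓ σ Z ts} k → Conf ℓ σ Z ts → Conf ℓ σ Z (take k ts)
  conf-take {ts = ts} k (conf inv vs) = conf (inv-drop++ (flat (drop k ts)) (inv-↭ p inv)) (All.take⁺ k vs)
    where
    xs = take k ts
    ys = drop k ts
    p : flat ts ++ R ↭ flat ys ++ flat xs ++ R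
    p = ↭-trans (↭-reflexive (trans (cong (λ zs → flat zs ++ R) (sym (List.take++drop≡id k ts)))
                             (trans (cong (_++ R) (flat-++ xs ys)) (List.++-assoc (flat xs) (flat ys) R))))
                (Perm.shifts (flat xs) (flat ys))

  module _ (Q : Automaton n → Set) (D : ℕ) .{{_ : NonZero D}} {k : ℕ} (14≤k : 14 ≤ k) where

    -- Three levels in which `M` collisions are affordable turn `2 * M` tasks into at least `8 * M`.
    -- At most `2 * M + 4 * M + 8 * M = 14 * M` pairs are processed, whence `14 ≤ k` for `ψ-small`,
    -- and at most `28 * M` states are added to those seen.
    chunk : ∀ N {σ Z ts ζ ℓ} M → Conf ℓ σ Z ts → length ts ≡ 2 * M → length Z ≤ ζ → 4 * (2 ^ k * (ζ + 28 * M)) ≤ n → D ≤ 2 ^ suc M →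
      (∀ {σ' Z' ts'} → Conf (3 + ℓ) σ' Z' ts' → length ts' ≡ 2 * (4 * M) → length Z' ≤ ζ + 28 * M → Bnd σ' Q N D) →
      Bnd σ Q (suc N) D
    chunk N {ζ = ζ} M c |ts|≡ |Z|≤ h≤n D≤ cont = err-small (ψ-small k M (work 3 (2 * M)) (≤-trans (≤-reflexive work≡) (*-monoˡ-≤ M 14≤k)) h≤n D≤)
      (explore Q N D (ζ + 28 * M) 3 M M (2 * M) c (≤-reflexive (trans (lemma₁ M) (sym |ts|≡))) (≤-reflexive |ts|≡) |Z|≤ work≤
        λ {_} {_} {ts'} c' ≤|ts'| |Z'|≤ → cont (conf-take (2 * (4 * M)) c')
          (trans (length-take (2 * (4 * M)) ts') (m≤n⇒m⊓n≡m (≤-trans (≤-reflexive (lemma₂ M)) ≤|ts'|)))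
          (≤-trans |Z'|≤ work≤))
      where
      open Error Q N D
      work≡ : work 3 (2 * M) ≡ 14 * M
      work≡ = lemma M
        where
        lemma : ∀ M → 2 * M + (2 * (2 * M) + (2 * (2 * (2 * M)) + 0)) ≡ 14 * M
        lemma = solve-∀
      work≤ : ζ + 2 * work 3 (2 * M) ≤ ζ + 28 * M
      work≤ = ≤-reflexive (cong (ζ +_) (trans (cong (2 *_) work≡) (sym (*-assoc 2 14 M))))
      lemma₁ : ∀ M → M + M ≡ 2 * M
      lemma₁ = solve-∀
      lemma₂ : ∀ M → 2 * (4 * M) ≡ 8 * M
      lemma₂ = solve-∀

    -- Each chunk adds `1 / D` to the error. The bound on the states seen is preserved because
    -- `16 * M + 28 * M ≤ 16 * (4 * M)`. The condition on `D` is tightest for the first chunk.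
    grow : ∀ g N {σ Z ts ζ ℓ} M → Conf ℓ σ Z ts → length ts ≡ 2 * M → length Z ≤ ζ + 16 * M → 4 * (2 ^ k * (ζ + 64 * (4 ^ g * M))) ≤ n → D ≤ 2 ^ suc M →
      (∀ {σ' Z' ts'} → Conf (3 * g + ℓ) σ' Z' ts' → length ts' ≡ 2 * (4 ^ g * M) → length Z' ≤ ζ + 16 * (4 ^ g * M) → Bnd σ' Q N D) →
      Bnd σ Q (g + N) D
    grow zero N {ζ = ζ} M c |ts|≡ |Z|≤ h≤n D≤ cont = cont c (trans |ts|≡ (cong (2 *_) (sym (*-identityˡ M))))
      (≤-trans |Z|≤ (≤-reflexive (cong (λ M → ζ + 16 * M) (sym (*-identityˡ M)))))
    grow (suc g) N {ζ = ζ} {ℓ} M c |ts|≡ |Z|≤ h≤n D≤ cont =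
      chunk (g + N) M c |ts|≡ |Z|≤ (≤-trans (*-monoʳ-≤ 4 (*-monoʳ-≤ (2 ^ k) enough)) h≤n) D≤ λ c' |ts'|≡ |Z'|≤ →
        grow g N {ζ = ζ} (4 * M) c' |ts'|≡ (≤-trans |Z'|≤ enough′) (≤-trans (≤-reflexive (cong (λ M → 4 * (2 ^ k * (ζ + 64 * M))) 4M≡)) h≤n)
          (≤-trans D≤ (^-monoʳ-≤ 2 (s≤s (m≤m+n M _)))) λ {σ'} {Z'} {ts'} c'' |ts''|≡ |Z''|≤ →
            cont (subst (λ ℓ → Conf ℓ σ' Z' ts') (lemma₁ g ℓ) c'') (trans |ts''|≡ (cong (2 *_) 4M≡))
              (≤-trans |Z''|≤ (≤-reflexive (cong (λ M → ζ + 16 * M) 4M≡)))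
      where
      open ≤-Reasoning
      lemma₁ : ∀ g ℓ → 3 * g + (3 + ℓ) ≡ 3 * suc g + ℓ
      lemma₁ = solve-∀
      4M≡ : 4 ^ g * (4 * M) ≡ 4 ^ suc g * M
      4M≡ = lemma (4 ^ g) M
        where
        lemma : ∀ x M → x * (4 * M) ≡ 4 * x * M
        lemma = solve-∀
      enough′ : ζ + 16 * M + 28 * M ≤ ζ + 16 * (4 * M)
      enough′ = begin
        ζ + 16 * M + 28 * M              ≤⟨ m≤m+n _ (20 * M) ⟩
        ζ + 16 * M + 28 * M + 20 * M     ≡⟨ lemma ζ M ⟩
        ζ + 16 * (4 * M)                 ∎
        where
        lemma : ∀ ζ M → ζ + 16 * M + 28 * M + 20 * M ≡ ζ + 16 * (4 * M)
        lemma = solve-∀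
      enough : ζ + 16 * M + 28 * M ≤ ζ + 64 * (4 ^ suc g * M)
      enough = begin
        ζ + 16 * M + 28 * M              ≤⟨ enough′ ⟩
        ζ + 16 * (4 * M)                 ≤⟨ +-monoʳ-≤ ζ (*-mono-≤ (m≤m+n 16 48) (≤-trans (m≤n*m (4 * M) (4 ^ g) {{m^n≢0 4 g}}) (≤-reflexive 4M≡))) ⟩
        ζ + 64 * (4 ^ suc g * M)         ∎

-- Merging two blocks of states

unique-++⇒disjoint : ∀ {A : Set} (xs : List A) {ys} → Unique (xs ++ ys) → ∀ {z} → z ∈ xs → z ∉ ys
unique-++⇒disjoint (x ∷ xs) (x∉ ∷ _) (here refl) z∈ys = All.lookup x∉ (∈-++⁺ʳ xs z∈ys) refl
unique-++⇒disjoint (x ∷ xs) (_ ∷ u)  (there z∈)  z∈ys = unique-++⇒disjoint xs u z∈ z∈ys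

unique-map-filter : ∀ {A B : Set} {P : A → Set} (f : A → B) (P? : ∀ x → Dec (P x)) {xs} → Unique (map f xs) → Unique (map f (filter P? xs))
unique-map-filter f P? u = AllPairs.map⁺ (AllPairs.filter⁺ P? (AllPairs.map⁻ u))

filter-↭ : ∀ {A B : Set} {P : A → Set} (f : A → B) (P? : ∀ x → Dec (P x)) xs → ∃ λ ys → map f xs ↭ ys ++ map f (filter P? xs)
filter-↭ f P? []       = [] , ↭-refl
filter-↭ f P? (x ∷ xs) with P? x | filter-↭ f P? xs
... | yes _ | ys , p = ys , ↭-trans (prep (f x) p) (↭-sym (Perm.shift (f x) ys _))
... | no  _ | ys , p = f x ∷ ys , prep (f x) p

^-mono-exp : ∀ {x n s t D} → x ≤ n → s ≤ t → D * x ^ s ≤ n ^ s → D * x ^ t ≤ n ^ t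
^-mono-exp {x} {n} {s} {t} {D} x≤n s≤t D≤ with m≤n⇒∃[o]m+o≡n s≤t
... | k , refl = begin
  D * x ^ (s + k)         ≡⟨ cong (D *_) (^-distribˡ-+-* x s k) ⟩
  D * (x ^ s * x ^ k)     ≡⟨ *-assoc D (x ^ s) (x ^ k) ⟨
  D * x ^ s * x ^ k       ≤⟨ *-mono-≤ D≤ (^-monoˡ-≤ k x≤n) ⟩
  n ^ s * n ^ k           ≡⟨ ^-distribˡ-+-* n s k ⟨
  n ^ (s + k)             ∎
  where open ≤-Reasoning

Agree : List (Edge n) → Automaton n → Automaton n → Set
Agree R A A' = ∀ e → e ∉ R → δᵉ A' e ≡ δᵉ A e

-- Merging that persists whatever values the edges in R take, so that these may still be revealed afterwards.
Mergeable : List (Edge n) → ℕ → Fin n → Fin n → Automaton n → Set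
Mergeable R L p q A = ∃ λ z → length z ≤ L × (∀ A' → Agree R A A' → δ* A' z p ≡ δ* A' z q)

NoMerge : List (Fin n) → List (Fin n) → List (Edge n) → ℕ → Automaton n → Set
NoMerge X Y R L A = ∀ {p q} → p ∈ X → q ∈ Y → ¬ Mergeable R L p q A

agree-⊨ : ∀ {σ : Partial n} {R A A'} → Unique (R ++ keys σ) → Agree R A A' → A ⊨ σ → A' ⊨ σ
agree-⊨ {R = R} u ag A⊨σ = All.tabulate λ {(e , v)} e∈ →
  trans (ag e (λ e∈R → unique-++⇒disjoint R u e∈R (∈-map⁺ proj₁ e∈))) (All.lookup A⊨σ e∈)

-- What is left of a task when its next step has been revealed in the left component only: the word now leads
-- some state in X to the value, and some state in Y to the yet unknown value at the edge.
record Half (n : ℕ) : Set where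
  constructor half
  field
    word  : Word
    value : Fin n
    edge  : Edge n

module Merging {n : ℕ} .{{_ : NonZero n}} (X Y : List (Fin n)) (R : List (Edge n)) where

  open Exploration X Y R
  open Growth X Y R
  open Popular (Half.word {n})
  open DecMembership (Fin._≟_ {n}) using (_∈?_)

  record ValidHalf (σ : Partial n) (ℓ : ℕ) (t : Half n) : Set where
    constructor valid
    field
      {x y}  : Fin n
      short  : length (Half.word t) ≤ ℓ
      x∈X    : x ∈ X
      y∈Y    : y ∈ Y
      path   : ∀ {A} → A ⊨ σ → δ* A (Half.word t) x ≡ Half.value t × δ* A (Half.word t) y ≡ δᵉ A (Half.edge t)

  validHalf-∷ : ∀ {σ ℓ t kv} → ValidHalf σ ℓ t → ValidHalf (kv ∷ σ) ℓ t
  validHalf-∷ (valid s x∈X y∈Y p) = valid s x∈X y∈Y λ { (_ ∷ A⊨σ) → p A⊨σ }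

  toHalf : ∀ {σ ℓ w c u v} u' → Valid σ ℓ (task w c u v) → ValidHalf (((c , u) , u') ∷ σ) (suc ℓ) (half (w ++ [ c ]) u' (c , v))
  toHalf {w = w} {c} u' (valid {x} {y} s x∈X y∈Y p) = valid (≤-trans (≤-reflexive (length-∷ʳ w c)) (s≤s s)) x∈X y∈Y λ { {A} (eu ∷ A⊨σ) →
    trans (δ*-∷ʳ A w c x) (trans (cong (δ A c) (proj₁ (p A⊨σ))) eu) ,
    trans (δ*-∷ʳ A w c y) (cong (δ A c) (proj₂ (p A⊨σ))) }

  module _ (Q : Automaton n → Set) (N D : ℕ) .{{_ : NonZero D}} (h : ℕ) where

    open Error Q N D

    -- Only left edges are revealed, so that the right values are still uniform in `collide`. A
    -- value that is kept lay outside the states seen and then joins them, hence the kept values are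
    -- distinct.
    halfLevel : ∀ ts {hs σ Z ζ ℓ} k →
      Inv σ Z (flat ts ++ map Half.edge hs ++ R) → All (Valid σ ℓ) ts → All (ValidHalf σ (suc ℓ)) hs →
      Unique (map Half.value hs) → All (_∈ Z) (map Half.value hs) →
      length Z ≤ ζ → ζ + length ts ≤ h →
      (∀ {σ' Z' hs'} → Inv σ' Z' (map Half.edge hs' ++ R) → All (ValidHalf σ' (suc ℓ)) hs' → Unique (map Half.value hs') →
        length ts + length hs ≤ length hs' + k → Bnd σ' Q N D) →
      Err σ (suc k) (ψ h (length ts) (suc k))
    halfLevel [] {hs} k inv vs ws ws! ws∈Z |Z|≤ζ ζ≤h cont = err-bnd (cont inv ws ws! (m≤m+n (length hs) k))
    halfLevel (task w c u v ∷ ts) {hs} {σ} {Z} {ζ} {ℓ} k inv (val ∷ vs) ws ws! ws∈Z |Z|≤ζ ζ≤h cont =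
      -- The recursion of `ψ` provides for two reveals per task; here there is only one.
      err-≤ (m≤m+n _ _) (err-branch (c , u) Z (≤-trans |Z|≤ζ (≤-trans (m≤m+n ζ _) ζ≤h))
        (λ p _ → kill k (inv-drop (inv-assign p inv)) (All.map valid-∷ vs) (All.map validHalf-∷ ws) cont)
        (λ p p∉Z → halfLevel ts {half (w ++ [ c ]) p (c , v) ∷ hs} k
          (inv-↭ (↭-sym (Perm.shift (c , v) (flat ts) _)) (inv-see {Z' = p ∷ Z} there (inv-assign p inv)))
          (All.map valid-∷ vs) (toHalf p val ∷ All.map validHalf-∷ ws)
          (All.map (λ { x∈Z refl → p∉Z x∈Z }) ws∈Z ∷ ws!) (here refl ∷ All.map there ws∈Z) (s≤s |Z|≤ζ)
          (≤-trans (≤-reflexive (sym (+-suc ζ (length ts)))) ζ≤h)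
          (λ inv' ws' ws'! ≤|hs'| → cont inv' ws' ws'! (≤-trans (≤-reflexive (sym (+-suc (length ts) (length hs)))) ≤|hs'|))))
      where
      kill : ∀ {σ'} k → Inv σ' Z (flat ts ++ map Half.edge hs ++ R) → All (Valid σ' ℓ) ts → All (ValidHalf σ' (suc ℓ)) hs →
        (∀ {σ' Z' hs'} → Inv σ' Z' (map Half.edge hs' ++ R) → All (ValidHalf σ' (suc ℓ)) hs' → Unique (map Half.value hs') →
          suc (length ts) + length hs ≤ length hs' + k → Bnd σ' Q N D) →
        Err σ' k (ψ h (length ts) k)
      kill zero    inv vs ws cont = err-top (inv-keys inv)
      kill (suc k) inv vs ws cont = halfLevel ts {hs} k inv vs ws ws! ws∈Z |Z|≤ζ (≤-trans (+-monoʳ-≤ ζ (n≤1+n (length ts))) ζ≤h)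
        (λ {_} {_} {hs'} inv' ws' ws'! ≤|hs'| → cont inv' ws' ws'! (≤-trans (s≤s ≤|hs'|) (≤-reflexive (sym (+-suc (length hs') k)))))

  -- The right value of `t` is uniform, and the class of its word in `hs` offers at least `θ`
  -- distinct left values. If it equals one of them, the common word takes a state in `X` and a
  -- state in `Y` to the same state. So each element of `gs` fails with probability at most
  -- `1 - θ / n`. The merging is insensitive to `R`, since both paths are determined by revealed
  -- edges, none of which is in `R`.
  collide : ∀ θ gs {hs σ Z ℓ} → All (λ t → θ ≤ length (class hs (Half.word t))) gs →
    Inv σ Z (map Half.edge gs ++ R) → All (ValidHalf σ ℓ) gs → All (ValidHalf σ ℓ) hs → Unique (map Half.value hs) →
    Bnd σ (NoMerge X Y R ℓ) ((n ∸ θ) ^ length gs) (n ^ length gs)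
  collide θ [] _ inv _ _ _ = bnd-top (inv-keys inv)
  collide θ (t ∷ gs) {hs} {σ} {Z} {ℓ} (θ≤ ∷ θs≤) inv (val ∷ vs) ws ws! =
    bnd-≤ {{m*n≢0 (n ^ length gs) n {{m^n≢0 n (length gs)}}}} total (bnd-reveal {N = N} e at)
    where
    open ≤-Reasoning
    e = Half.edge t
    C = map Half.value (class hs (Half.word t))
    r = (n ∸ θ) ^ length gs
    N : Fin n → ℕ
    N v with v ∈? C
    ... | yes _ = 0
    ... | no  _ = r
    hit : ∀ v → v ∈ C → ∀ {A} → A ⊨ (e , v) ∷ σ → ¬ NoMerge X Y R ℓ A
    hit v v∈C {A} (ev ∷ A⊨σ) noMerge with ∈-map⁻ Half.value v∈C
    ... | t' , t'∈ , refl with ∈-filter⁻ (λ t' → Half.word t' ≟ʷ Half.word t) {xs = hs} t'∈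
    ...   | t'∈hs , eq = noMerge (ValidHalf.x∈X val') (ValidHalf.y∈Y val)
            (Half.word t , ValidHalf.short val , λ A' ag → let A'⊨ = agree-⊨ R! ag (ev ∷ A⊨σ) in
              trans (subst (λ z → δ* A' z (ValidHalf.x val') ≡ Half.value t') eq (proj₁ (ValidHalf.path val' (All.tail A'⊨))))
                    (sym (trans (proj₂ (ValidHalf.path val (All.tail A'⊨))) (All.head A'⊨))))
      where
      val' = All.lookup ws t'∈hs
      R! : Unique (R ++ keys ((e , v) ∷ σ))
      R! = Inv.unique (inv-drop++ (map Half.edge gs) (inv-assign v inv))
    at : ∀ v → Bnd ((e , v) ∷ σ) (NoMerge X Y R ℓ) (N v) (n ^ length gs)
    at v with v ∈? C
    ... | yes v∈C = bnd-absurd (hit v v∈C)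
    ... | no  _   = collide θ gs θs≤ (inv-assign v inv) (All.map validHalf-∷ vs) (All.map validHalf-∷ ws) ws!
    ∑N≤ : ∑ (allFin n) N ≤ (n ∸ θ) * r
    ∑N≤ = begin
      ∑ (allFin n) N                    ≤⟨ m+n≤o⇒m≤o∸n _ (≤-trans (+-monoʳ-≤ _ (*-monoˡ-≤ r θ≤′)) vanish) ⟩
      n * r ∸ θ * r                     ≡⟨ *-distribʳ-∸ r n θ ⟨
      (n ∸ θ) * r                       ∎
      where
      θ≤′ : θ ≤ length C
      θ≤′ = ≤-trans θ≤ (≤-reflexive (sym (length-map Half.value (class hs (Half.word t)))))
      N≡0 : ∀ {v} → v ∈ C → N v ≡ 0
      N≡0 {v} v∈C with v ∈? C
      ... | yes _   = refl
      ... | no v∉C = contradiction v∈C v∉C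
      N≤r : ∀ v → N v ≤ r
      N≤r v with v ∈? C
      ... | yes _ = z≤n
      ... | no  _ = ≤-refl
      vanish : ∑ (allFin n) N + length C * r ≤ n * r
      vanish = ≤-trans (∑-vanishing Fin._≟_ (unique-map-filter Half.value _ ws!) ∈-allFin N≡0 N≤r)
                       (≤-reflexive (cong (_* r) (length-tabulate {n = n} id)))
    total : ∑ (allFin n) N * n ^ suc (length gs) ≤ (n ∸ θ) ^ suc (length gs) * (n ^ length gs * n)
    total = *-mono-≤ ∑N≤ (≤-reflexive (*-comm n (n ^ length gs)))

  -- The growth costs `g / D`, the half level and the collisions `1 / D` each. Of the `2 * M'`
  -- pairs, where `M' = 4 ^ g * M`, at least `M'` survive the half level. There are fewer than
  -- `2 ^ (2 + 3 * g)` words of length at most `3 * g + 1`, so at least `s` of the survivors carry a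
  -- word shared by `θ` or more.
  merging : ∀ D .{{_ : NonZero D}} {k} → 14 ≤ k → ∀ g {σ Z ts ζ} M θ s →
    Conf 0 σ Z ts → length ts ≡ 2 * M → length Z ≤ ζ + 16 * M →
    4 * (2 ^ k * (ζ + 64 * (4 ^ g * M))) ≤ n → D ≤ 2 ^ suc M →
    s + 2 ^ (2 + 3 * g) * θ ≤ 4 ^ g * M → D * (n ∸ θ) ^ s ≤ n ^ s →
    Bnd σ (NoMerge X Y R (suc (3 * g))) (g + 2) D
  merging D {k} 14≤k g {ζ = ζ} M θ s c |ts|≡ |Z|≤ h≤n D≤ s+Tθ≤ D[n-θ]^s≤ =
    grow Q D 14≤k g 2 {ζ = ζ} M c |ts|≡ |Z|≤ h≤n D≤ λ {σ'} {Z'} {ts'} c' |ts'|≡ |Z'|≤ → stage {ζ' = ζ + 16 * M'} (subst (λ ℓ → Conf ℓ σ' Z' ts') (+-identityʳ (3 * g)) c') |ts'|≡ |Z'|≤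
      (≤-trans (*-monoʳ-≤ 4 (*-monoʳ-≤ (2 ^ k) enough)) h≤n)
    where
    open ≤-Reasoning
    L = suc (3 * g)
    Q = NoMerge X Y R L
    M' = 4 ^ g * M
    enough : ζ + 16 * M' + 2 * M' ≤ ζ + 64 * M'
    enough = ≤-trans (m≤m+n _ (46 * M')) (≤-reflexive (lemma ζ M'))
      where
      lemma : ∀ ζ M → ζ + 16 * M + 2 * M + 46 * M ≡ ζ + 64 * M
      lemma = solve-∀
    stage : ∀ {σ Z ts ζ'} → Conf (3 * g) σ Z ts → length ts ≡ 2 * M' → length Z ≤ ζ' → 4 * (2 ^ k * (ζ' + 2 * M')) ≤ n → Bnd σ Q 2 D
    stage {σ} {Z} {ts} {ζ'} (conf inv vs) |ts|≡ |Z|≤ h≤n =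
      Error.err-small Q 1 D
        (ψ-small k M' (length ts) (≤-trans (≤-reflexive |ts|≡) (*-monoˡ-≤ M' (≤-trans (m≤m+n 2 12) 14≤k))) h≤n
          (≤-trans D≤ (^-monoʳ-≤ 2 (s≤s (m≤n*m M (4 ^ g) {{m^n≢0 4 g}})))))
        (halfLevel Q 1 D (ζ' + 2 * M') ts {[]} M' inv vs [] [] [] |Z|≤ (≤-reflexive (cong (ζ' +_) |ts|≡))
          λ {_} {_} {hs} inv' ws ws! ≤|hs| → finish hs inv' ws ws! (+-cancelʳ-≤ M' M' (length hs) (≤-trans (≤-reflexive (trans (lemma M') (cong (_+ 0) (sym |ts|≡)))) ≤|hs|)))
      where
      lemma : ∀ M → M + M ≡ 2 * M + 0
      lemma = solve-∀
      finish : ∀ {σ Z} hs → Inv σ Z (map Half.edge hs ++ R) → All (ValidHalf σ L) hs → Unique (map Half.value hs) → M' ≤ length hs → Bnd σ Q 1 D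
      finish {σ} {Z} hs inv ws ws! M'≤ =
        bnd-≤ {{m^n≢0 n (length gs)}} (≤-trans (≤-reflexive (*-comm ((n ∸ θ) ^ length gs) D)) (≤-trans (^-mono-exp {D = D} (m∸n≤m n θ) s≤ D[n-θ]^s≤) (≤-reflexive (sym (*-identityˡ _)))))
          (collide θ gs {hs} (All.tabulate λ t∈ → proj₂ (∈-filter⁻ (popular? θ hs) {xs = hs} t∈)) invg
            (All.filter⁺ (popular? θ hs) ws) ws ws!)
        where
        gs = popular θ hs
        s≤ : s ≤ length gs
        s≤ = +-cancelʳ-≤ (2 ^ (2 + 3 * g) * θ) s (length gs) (begin
          s + 2 ^ (2 + 3 * g) * θ                           ≤⟨ s+Tθ≤ ⟩
          M'                                                ≤⟨ M'≤ ⟩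
          length hs                                         ≤⟨ length-popular θ (wordsUpTo L) hs (All.map (λ {t} w → ∈-wordsUpTo (Half.word t) (ValidHalf.short w)) ws) ⟩
          length gs + length (wordsUpTo L) * θ              ≤⟨ +-monoʳ-≤ (length gs) (*-monoˡ-≤ θ (≤-trans (n≤1+n _) (≤-reflexive (length-wordsUpTo L)))) ⟩
          length gs + 2 ^ (2 + 3 * g) * θ                   ∎)
        E×p = filter-↭ Half.edge (popular? θ hs) hs
        invg : Inv σ Z (map Half.edge gs ++ R)
        invg = inv-drop++ (proj₁ E×p) (inv-↭ (↭-trans (Perm.++⁺ʳ R (proj₂ E×p)) (↭-reflexive (List.++-assoc (proj₁ E×p) _ R))) inv)

-- Hitting a mergeable pair

_≟ᵉ_ : DecidableEquality (Edge n)
_≟ᵉ_ = ≡-dec _≟ˡ_ Fin._≟_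

edgesOf : ∀ n → List (Edge n)
edgesOf n = cartesianProduct (a ∷ b ∷ []) (allFin n)

∈-edgesOf : ∀ (e : Edge n) → e ∈ edgesOf n
∈-edgesOf (a , s) = ∈-cartesianProduct⁺ {xs = a ∷ b ∷ []} (here refl) (∈-allFin s)
∈-edgesOf (b , s) = ∈-cartesianProduct⁺ {xs = a ∷ b ∷ []} (there (here refl)) (∈-allFin s)

module _ {n : ℕ} .{{_ : NonZero n}} {Q : Automaton n → Set} {N D : ℕ} .{{_ : NonZero D}} where

  open DecMembership (_≟ᵉ_ {n}) using (_∈?_)

  -- Averaging over the values of further edges keeps the bound. Once `es` contains all edges, the
  -- automata that remain agree outside `R`, and one of them can represent them all.
  revealOff : ∀ R es {σ} → Unique (R ++ keys σ) →
    (∀ {σ'} → (∀ {A} → A ⊨ σ' → A ⊨ σ) → Unique (R ++ keys σ') → (∀ {e} → e ∈ es → e ∉ R → e ∈ keys σ') →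
      (∀ {e} → e ∈ keys σ → e ∈ keys σ') → Bnd σ' Q N D) →
    Bnd σ Q N D
  revealOff R [] u cont = cont id u (λ ()) id
  revealOff R (e ∷ es) {σ} u cont with e ∈? R | e ∈? keys σ
  ... | yes e∈R | _ = revealOff R es u λ sub u' all∈ keep →
    cont sub u' (λ { (here refl) e∉R → contradiction e∈R e∉R ; (there e∈) e∉R → all∈ e∈ e∉R }) keep
  ... | no _ | yes e∈σ = revealOff R es u λ sub u' all∈ keep →
    cont sub u' (λ { (here refl) _ → keep e∈σ ; (there e∈) e∉R → all∈ e∈ e∉R }) keep
  ... | no e∉R | no e∉σ = bnd-≤ {{m*n≢0 D n}} (≤-reflexive total) (bnd-reveal {N = λ _ → N} e λ v →
    revealOff R es (unique-↭ (↭-sym (Perm.shift e R (keys σ))) (All.tabulate fresh ∷ u)) λ sub u' all∈ keep →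
      cont (All.tail ∘ sub) u' (λ { (here refl) _ → keep (here refl) ; (there e∈) e∉R → all∈ e∈ e∉R }) (keep ∘ there))
    where
    fresh : ∀ {e'} → e' ∈ R ++ keys σ → e ≢ e'
    fresh e'∈ refl with ∈-++⁻ R e'∈
    ... | inj₁ e∈R = e∉R e∈R
    ... | inj₂ e∈σ = e∉σ e∈σ
    total : ∑ (allFin n) (λ _ → N) * D ≡ N * (D * n)
    total = trans (cong (_* D) (trans (∑-const (allFin n) N) (cong (_* N) (length-tabulate {n = n} id)))) (lemma n N D)
      where
      lemma : ∀ n N D → n * N * D ≡ N * (D * n)
      lemma = solve-∀

¬¬-shift : ∀ {I : Set} {P : I → Set} is → (∀ i → ¬ ¬ P i) → ¬ ¬ All P is
¬¬-shift []       p k = k []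
¬¬-shift (i ∷ is) p k = p i λ pi → ¬¬-shift is p λ pis → k (pi ∷ pis)

module Start {n : ℕ} .{{_ : NonZero n}} (X Y : List (Fin n)) (R : List (Edge n)) where

  open Exploration X Y R

  zipTasks : List (Fin n) → List (Fin n) → List (Task n)
  zipTasks (x ∷ xs) (y ∷ ys) = task [] a x y ∷ zipTasks xs ys
  zipTasks _        _        = []

  zipSeen : List (Fin n) → List (Fin n) → List (Fin n) → List (Fin n)
  zipSeen (x ∷ xs) (y ∷ ys) Z = y ∷ x ∷ zipSeen xs ys Z
  zipSeen _        _        Z = Z

  ∉-zipSeen : ∀ {xs ys Z z} → z ∉ xs → z ∉ ys → z ∉ Z → z ∉ zipSeen xs ys Z
  ∉-zipSeen {[]}              _    _    z∉Z = z∉Z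
  ∉-zipSeen {_ ∷ _} {[]}      _    _    z∉Z = z∉Z
  ∉-zipSeen {_ ∷ _} {_ ∷ _} z∉xs z∉ys z∉Z (here refl)          = z∉ys (here refl)
  ∉-zipSeen {_ ∷ _} {_ ∷ _} z∉xs z∉ys z∉Z (there (here refl))  = z∉xs (here refl)
  ∉-zipSeen {_ ∷ _} {_ ∷ _} z∉xs z∉ys z∉Z (there (there z∈))   = ∉-zipSeen (z∉xs ∘ there) (z∉ys ∘ there) z∉Z z∈

  conf-start : ∀ {σ Z} xs ys → length xs ≡ length ys → (∀ {z} → z ∈ xs → z ∈ X × z ∉ Z) → (∀ {z} → z ∈ ys → z ∈ Y × z ∉ Z) →
    Unique xs → Unique ys → (∀ {z} → z ∈ xs → z ∉ ys) → Inv σ Z R → Conf 0 σ (zipSeen xs ys Z) (zipTasks xs ys)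
  conf-start []       []       _   _ _ _ _ _ inv = conf inv []
  conf-start {σ} (x ∷ xs) (y ∷ ys) |xs|≡|ys| X∋ Y∋ (x∉xs ∷ xs!) (y∉ys ∷ ys!) disj inv
    with conf-start xs ys (suc-injective |xs|≡|ys|) (X∋ ∘ there) (Y∋ ∘ there) xs! ys! (λ z∈ → disj (there z∈) ∘ there) inv
  ... | conf inv' vs = conf
    -- The first letter read is always `a`, so the edges with letter `b` are withdrawn.
    (inv-drop++ ((b , x) ∷ (b , y) ∷ []) (inv-↭ (Perm.shifts ((a , x) ∷ (a , y) ∷ []) ((b , x) ∷ (b , y) ∷ []))
       (inv-children [] a x∉ y∉ inv')))
    (valid z≤n (proj₁ (X∋ (here refl))) (proj₁ (Y∋ (here refl))) (λ _ → refl , refl) ∷ vs)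
    where
    x∉ = ∉-zipSeen (λ x∈ → All.lookup x∉xs x∈ refl) (disj (here refl) ∘ there) (proj₂ (X∋ (here refl)))
    y∉ : y ∉ x ∷ zipSeen xs ys _
    y∉ (here refl) = disj (here refl) (here refl)
    y∉ (there y∈)  = ∉-zipSeen (λ y∈xs → disj (there y∈xs) (here refl)) (λ y∈ → All.lookup y∉ys y∈ refl) (proj₂ (Y∋ (here refl))) y∈

  length-zipTasks : ∀ xs ys → length xs ≡ length ys → length (zipTasks xs ys) ≡ length xs
  length-zipTasks []       []       _  = refl
  length-zipTasks (x ∷ xs) (y ∷ ys) eq = cong suc (length-zipTasks xs ys (suc-injective eq))

  length-zipSeen : ∀ xs ys Z → length xs ≡ length ys → length (zipSeen xs ys Z) ≡ 2 * length xs + length Z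
  length-zipSeen []       []       Z _  = refl
  length-zipSeen (x ∷ xs) (y ∷ ys) Z eq = trans (cong (suc ∘ suc) (length-zipSeen xs ys Z (suc-injective eq))) (lemma (length xs) (length Z))
    where
    lemma : ∀ l z → suc (suc (2 * l + z)) ≡ 2 * suc l + z
    lemma = solve-∀

module Unseen {n : ℕ} (Z : List (Fin n)) where

  open DecMembership (Fin._≟_ {n}) using (_∈?_)

  unseen : List (Fin n)
  unseen = filter (λ s → ¬? (s ∈? Z)) (allFin n)

  length-unseen : n ≤ length unseen + length Z
  length-unseen = begin
    n                                                 ≡⟨ length-tabulate {n = n} id ⟨
    length (allFin n)                                 ≤⟨ length-⊆ (Unique.allFin⁺ n) allFin⊆ ⟩
    length (unseen ++ Z)                              ≡⟨ length-++ unseen ⟩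
    length unseen + length Z                          ∎
    where
    open ≤-Reasoning
    allFin⊆ : ∀ {s} → s ∈ allFin n → s ∈ unseen ++ Z
    allFin⊆ {s} s∈ with s ∈? Z
    ... | yes s∈Z = ∈-++⁺ʳ unseen s∈Z
    ... | no  s∉Z = ∈-++⁺ˡ (∈-filter⁺ (λ s → ¬? (s ∈? Z)) s∈ s∉Z)

  module _ {m : ℕ} (m+|Z|≤n : m + length Z ≤ n) where

    m≤ : m ≤ length unseen
    m≤ = +-cancelʳ-≤ (length Z) m (length unseen) (≤-trans m+|Z|≤n length-unseen)

    pick : Fin m → Fin n
    pick i = lookup unseen (inject≤ i m≤)

    pick∉Z : ∀ i → pick i ∉ Z
    pick∉Z i = proj₂ (∈-filter⁻ (λ s → ¬? (s ∈? Z)) {xs = allFin n} (∈-lookup {xs = unseen} (inject≤ i m≤)))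

    pick-injective : ∀ {i j} → pick i ≡ pick j → i ≡ j
    pick-injective {i} {j} eq = Fin.inject≤-injective m≤ m≤ i j (unique-lookup (Unique.filter⁺ _ (Unique.allFin⁺ n)) _ _ eq)
      where
      unique-lookup : ∀ {xs : List (Fin n)} → Unique xs → ∀ i j → lookup xs i ≡ lookup xs j → i ≡ j
      unique-lookup (_ ∷ _)    fzero    fzero    _  = refl
      unique-lookup (x∉ ∷ _)   fzero    (fsuc j) eq = contradiction eq (All.lookup x∉ (∈-lookup j))
      unique-lookup (x∉ ∷ _)   (fsuc i) fzero    eq = contradiction (sym eq) (All.lookup x∉ (∈-lookup i))
      unique-lookup (_ ∷ xs!)  (fsuc i) (fsuc j) eq = cong fsuc (unique-lookup xs! i j eq)

module Hitting {n : ℕ} .{{_ : NonZero n}} (x y : Fin n) (Q : Automaton n → Set) (Ltot : ℕ)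
  (Q⇒¬merge : ∀ {A} → Q A → ¬ MergeWithin A Ltot x y) where

  open Exploration [ x ] [ y ] []
  open DecMembership (≡-dec (Fin._≟_ {n}) (Fin._≟_ {n})) using (_∈?_)

  δ*-++ : ∀ (A : Automaton n) w z s → δ* A (w ++ z) s ≡ δ* A z (δ* A w s)
  δ*-++ A w z s = foldl-++ _ s w z

  path-from : ∀ {σ ℓ t} → Valid σ ℓ t → length (word t) ≤ ℓ × (∀ {A} → A ⊨ σ → δ* A (word t) x ≡ left t × δ* A (word t) y ≡ right t)
  path-from (valid short (here refl) (here refl) path) = short , path

  -- The next letter takes a task to a uniform pair. If this pair lies in `M`, the word merging it
  -- in `A₀` also merges it in every automaton that agrees with `A₀` outside `R`; appended to the
  -- path of the task it merges `x` and `y`.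
  hit : ∀ ts {σ R L ℓ A₀ M} → Unique M → (∀ {p q} → (p , q) ∈ M → Mergeable R L p q A₀) → suc ℓ + L ≤ Ltot →
    (∀ {A} → A ⊨ σ → Agree R A₀ A) → Unique (flat ts ++ keys σ) → All (Valid σ ℓ) ts →
    Bnd σ Q ((n * n ∸ length M) ^ length ts) ((n * n) ^ length ts)
  hit [] _ _ _ _ u _ = bnd-top u
  hit (task w c u v ∷ ts) {σ} {R} {L} {ℓ} {A₀} {M} M! merge ≤Ltot agree uniq (val ∷ vs) =
    bnd-≤ {{m*n≢0 (E * n) n {{m*n≢0 E n {{E≢0}}}}}} total
      (bnd-reveal {N = λ p → ∑ (allFin n) (λ q → N (p , q))} (c , u) λ p →
        bnd-reveal {N = λ q → N (p , q)} (c , v) (at p))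
    where
    open ≤-Reasoning
    E = (n * n) ^ length ts
    E≢0 : NonZero E
    E≢0 = m^n≢0 (n * n) (length ts) {{m*n≢0 n n}}
    r = (n * n ∸ length M) ^ length ts
    N : Fin n × Fin n → ℕ
    N pq with pq ∈? M
    ... | yes _ = 0
    ... | no  _ = r
    collision : ∀ {p q} → (p , q) ∈ M → ∀ {A} → A ⊨ ((c , v) , q) ∷ ((c , u) , p) ∷ σ → ¬ Q A
    collision {p} {q} pq∈M {A} (ev ∷ eu ∷ A⊨σ) QA with merge pq∈M
    ... | z , |z|≤L , robust = Q⇒¬merge QA (w ++ [ c ] ++ z , len , trans (image x (proj₁ (path A⊨σ)) eu) (trans (robust A (agree A⊨σ)) (sym (image y (proj₂ (path A⊨σ)) ev))))
      where
      short = proj₁ (path-from val)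
      path = proj₂ (path-from val)
      len : length (w ++ [ c ] ++ z) ≤ Ltot
      len = begin
        length (w ++ [ c ] ++ z)      ≡⟨ length-++ w ⟩
        length w + suc (length z)     ≤⟨ +-mono-≤ short (s≤s |z|≤L) ⟩
        ℓ + suc L                     ≡⟨ +-suc ℓ L ⟩
        suc ℓ + L                     ≤⟨ ≤Ltot ⟩
        Ltot                          ∎
      image : ∀ s {s' s''} → δ* A w s ≡ s' → δ A c s' ≡ s'' → δ* A (w ++ [ c ] ++ z) s ≡ δ* A z s''
      image s refl refl = δ*-++ A w ([ c ] ++ z) s
    at : ∀ p q → Bnd (((c , v) , q) ∷ ((c , u) , p) ∷ σ) Q (N (p , q)) E
    at p q with (p , q) ∈? M
    ... | yes pq∈M = bnd-absurd (collision pq∈M)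
    ... | no  _    = hit ts M! merge ≤Ltot (λ { (_ ∷ _ ∷ A⊨σ) → agree A⊨σ })
      (unique-↭ (↭-sym (↭-trans (Perm.shift (c , v) (flat ts) ((c , u) ∷ keys σ)) (↭-trans (prep (c , v) (Perm.shift (c , u) (flat ts) (keys σ))) ↭-swap′))) uniq)
      (All.map valid-∷∷ vs)
      where
      ↭-swap′ : (c , v) ∷ (c , u) ∷ flat ts ++ keys σ ↭ (c , u) ∷ (c , v) ∷ flat ts ++ keys σ
      ↭-swap′ = Perm.shift (c , u) [ (c , v) ] (flat ts ++ keys σ)
    pairs = cartesianProduct (allFin n) (allFin n)
    length-pairs : length pairs ≡ n * n
    length-pairs = trans (length-cartesianProductWith _,_ (allFin n) (allFin n)) (cong₂ _*_ (length-tabulate {n = n} id) (length-tabulate {n = n} id))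
    N≡0 : ∀ {pq} → pq ∈ M → N pq ≡ 0
    N≡0 {pq} pq∈M with pq ∈? M
    ... | yes _    = refl
    ... | no pq∉M = contradiction pq∈M pq∉M
    N≤r : ∀ pq → N pq ≤ r
    N≤r pq with pq ∈? M
    ... | yes _ = z≤n
    ... | no  _ = ≤-refl
    S = ∑ (allFin n) (λ p → ∑ (allFin n) (λ q → N (p , q)))
    ∑N≤ : S ≤ (n * n ∸ length M) * r
    ∑N≤ = begin
      S                              ≡⟨ ∑-cartesianProduct (allFin n) (allFin n) N ⟨
      ∑ pairs N                      ≤⟨ m+n≤o⇒m≤o∸n _ (∑-vanishing (≡-dec Fin._≟_ Fin._≟_) M! (λ (p , q) → ∈-cartesianProduct⁺ (∈-allFin p) (∈-allFin q)) N≡0 N≤r) ⟩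
      length pairs * r ∸ length M * r ≡⟨ cong (λ l → l * r ∸ length M * r) length-pairs ⟩
      n * n * r ∸ length M * r       ≡⟨ *-distribʳ-∸ r (n * n) (length M) ⟨
      (n * n ∸ length M) * r         ∎
    total : S * (n * n * E) ≤ (n * n ∸ length M) * r * (E * n * n)
    total = *-mono-≤ ∑N≤ (≤-reflexive (lemma n E))
      where
      lemma : ∀ n E → n * n * E ≡ E * n * n
      lemma = solve-∀

module Leaves {n : ℕ} .{{_ : NonZero n}} (x y : Fin n) (Q : Automaton n → Set) (Ltot : ℕ)
  (Q⇒¬merge : ∀ {A} → Q A → ¬ MergeWithin A Ltot x y) where

  open Hitting x y Q Ltot Q⇒¬merge

  -- Either every automaton satisfying `σ` misses some pair of blocks, and the event is impossible,
  -- or some `A₀` misses none. In the second case one mergeable pair is chosen from each pair of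
  -- blocks. The choices are distinct as the blocks are disjoint, and they serve all automata
  -- satisfying `σ`, which agree outside `R`.
  hit-blocks : ∀ {I J : Set} (is : List (I × J)) {D t ts σ R L ℓ} .{{_ : NonZero D}} {X : I → List (Fin n)} {Y : J → List (Fin n)} →
    Unique is → (∀ {i i' p} → p ∈ X i → p ∈ X i' → i ≡ i') → (∀ {j j' q} → q ∈ Y j → q ∈ Y j' → j ≡ j') →
    (∀ {A A'} → A ⊨ σ → A' ⊨ σ → Agree R A A') → Unique (flat ts ++ keys σ) → All (Exploration.Valid [ x ] [ y ] [] σ ℓ) ts →
    suc ℓ + L ≤ Ltot → t ≤ length ts → D * (n * n ∸ length is) ^ t ≤ (n * n) ^ t →
    Bnd σ (λ A → Q A × ¬ ∃ λ ((i , j) : I × J) → (i , j) ∈ is × NoMerge (X i) (Y j) R L A) 1 D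
  hit-blocks {I} {J} is {D} {t} {ts} {σ} {R} {L} {ℓ} {X} {Y} is! X-disjoint Y-disjoint agree u vs ≤Ltot t≤ D≤ =
    bnd-stable λ ¬B → ¬¬-excluded-middle {A = ∃ λ A → A ⊨ σ × ∀ {ij} → ij ∈ is → ¬ NoMerge (X (proj₁ ij)) (Y (proj₂ ij)) R L A} λ where
      (no ∄A) → ¬B (bnd-absurd λ {A} A⊨σ (q , ¬∃) → ∄A (A , A⊨σ , λ {ij} ij∈ nm → ¬∃ (ij , ij∈ , nm)))
      -- `NoMerge` is a negation, so each mergeable pair is only obtained up to double negation;
      -- finitely many of these can be combined.
      (yes (A₀ , A₀⊨σ , ¬NM)) → ¬¬-shift {P = λ ij → ij ∈ is → Pair A₀ ij} is (λ ij k → k λ ij∈ → ⊥-elim (¬NM ij∈ λ p∈ q∈ mg → k λ _ → (_ , _) , p∈ , q∈ , mg))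
        λ all → ¬B (conclude A₀ A₀⊨σ is! (All.tabulate λ ij∈ → All.lookup all ij∈ ij∈))
    where
    Pair : Automaton n → I × J → Set
    Pair A (i , j) = ∃ λ ((p , q) : Fin n × Fin n) → p ∈ X i × q ∈ Y j × Mergeable R L p q A
    pairs : ∀ {A is} → All (Pair A) is → List (Fin n × Fin n)
    pairs []             = []
    pairs ((pq , _) ∷ ps) = pq ∷ pairs ps
    length-pairs : ∀ {A is} (ps : All (Pair A) is) → length (pairs ps) ≡ length is
    length-pairs []       = refl
    length-pairs (_ ∷ ps) = cong suc (length-pairs ps)
    pairs-mergeable : ∀ {A is} (ps : All (Pair A) is) {p q} → (p , q) ∈ pairs ps → Mergeable R L p q A
    pairs-mergeable ((_ , _ , _ , mg) ∷ ps) (here refl) = mg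
    pairs-mergeable (_ ∷ ps)                (there pq∈) = pairs-mergeable ps pq∈
    pairs-unique : ∀ {A is} (ps : All (Pair A) is) → Unique is → Unique (pairs ps)
    pairs-unique []       _            = []
    pairs-unique ((_ , p∈ , q∈ , _) ∷ ps) (ij∉ ∷ is!) = differ ps ij∉ ∷ pairs-unique ps is!
      where
      differ : ∀ {is'} (ps : All (Pair _) is') → All (_ ≢_) is' → All (_ ≢_) (pairs ps)
      differ []                           []           = []
      differ ((_ , p'∈ , q'∈ , _) ∷ ps) (ij≢ ∷ ijs≢) =
        (λ { refl → ij≢ (cong₂ _,_ (X-disjoint p∈ p'∈) (Y-disjoint q∈ q'∈)) }) ∷ differ ps ijs≢
    conclude : ∀ A₀ → A₀ ⊨ σ → Unique is → All (Pair A₀) is → Bnd σ (λ A → Q A × _) 1 D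
    conclude A₀ A₀⊨σ is! ps = bnd-weaken (λ _ → proj₁)
      (bnd-≤ {{m^n≢0 (n * n) (length ts) {{m*n≢0 n n}}}}
        (≤-trans (≤-reflexive (trans (*-comm _ D) (cong (λ l → D * (n * n ∸ l) ^ length ts) (length-pairs ps))))
          (≤-trans (^-mono-exp {D = D} (m∸n≤m (n * n) (length is)) t≤ D≤) (≤-reflexive (sym (*-identityˡ _)))))
        (hit ts {A₀ = A₀} (pairs-unique ps is!) (pairs-mergeable ps) ≤Ltot (agree A₀⊨σ) u vs))

  -- The pending edges of the branches form `R`, so that exploring the blocks leaves the next step
  -- of every branch uniform. Each of the `β * β` pairs of blocks is missed with probability at most
  -- `(g + 2) / D`; the last `1 / D` is for the case that no pair is missed and yet all branches
  -- fail.
  leaves : ∀ D .{{_ : NonZero D}} {k} → 14 ≤ k → ∀ g β M θ s t {σ Z ts ℓ ζ} →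
    Exploration.Conf [ x ] [ y ] [] ℓ σ Z ts → length Z ≤ ζ → 2 * (β * (2 * M)) + ζ ≤ n →
    4 * (2 ^ k * (ζ + 64 * (4 ^ g * M))) ≤ n → D ≤ 2 ^ suc M →
    s + 2 ^ (2 + 3 * g) * θ ≤ 4 ^ g * M → D * (n ∸ θ) ^ s ≤ n ^ s →
    t ≤ length ts → D * (n * n ∸ β * β) ^ t ≤ (n * n) ^ t → suc ℓ + suc (3 * g) ≤ Ltot →
    Bnd σ Q (β * β * (g + 2) + 1) D
  leaves D {k} 14≤k g β M θ s t {σ} {Z} {ts} {ℓ} {ζ} (Exploration.conf inv vs) |Z|≤ blocks≤n h≤n D≤ s+Tθ≤ D[n-θ]^s≤ t≤ Dhit≤ ≤Ltot =
    bnd-cases {P = Missed}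
      (bnd-weaken (λ _ → proj₂) (subst (λ l → Bnd σ Missed (l * (g + 2)) D) length-is (bnd-∃ {Q = λ (i , j) → NoMerge (X i) (Y j) R L} is noMerge)))
      (revealOff R (edgesOf n) (Inv.unique inv′) λ {σ'} sub u all∈ _ →
        hit-blocks is {X = X} {Y} is! (λ {i} {i'} → X-disjoint i i') (λ {j} {j'} → Y-disjoint j j')
          (λ {A} {A'} A⊨ A'⊨ e e∉R → agree A⊨ A'⊨ (all∈ (∈-edgesOf e) e∉R)) u (All.map (weaken sub) vs) ≤Ltot t≤
          (subst (λ l → D * (n * n ∸ l) ^ t ≤ (n * n) ^ t) (sym length-is) Dhit≤))
    where
    open Unseen Z
    m = 2 * M
    R = flat ts
    L = suc (3 * g)
    is = cartesianProduct (allFin β) (allFin β)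
    is! = Unique.cartesianProduct⁺ (Unique.allFin⁺ β) (Unique.allFin⁺ β)
    length-is : length is ≡ β * β
    length-is = trans (length-cartesianProductWith _,_ (allFin β) (allFin β)) (cong₂ _*_ (length-tabulate {n = β} id) (length-tabulate {n = β} id))
    inv′ : Inv σ Z R
    inv′ = subst (Inv σ Z) (List.++-identityʳ R) inv
    fits : 2 * (β * m) + length Z ≤ n
    fits = ≤-trans (+-monoʳ-≤ (2 * (β * m)) |Z|≤) blocks≤n
    -- The first index selects the family `X` or `Y`, the second the block and the third the
    -- position in it.
    element : Fin 2 → Fin β → Fin m → Fin n
    element c i l = pick fits (combine c (combine i l))
    block : Fin 2 → Fin β → List (Fin n)
    block c i = tabulate (element c i)
    X Y : Fin β → List (Fin n)
    X = block fzero
    Y = block (fsuc fzero)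
    block-index : ∀ {c c' i i' l l'} → element c i l ≡ element c' i' l' → c ≡ c' × i ≡ i' × l ≡ l'
    block-index {c} {c'} {i} {i'} {l} {l'} eq with Fin.combine-injective c (combine i l) c' (combine i' l') (pick-injective fits eq)
    ... | c≡ , eq' = c≡ , Fin.combine-injective i l i' l' eq'
    block-disjoint : ∀ c c' i i' {s} → s ∈ block c i → s ∈ block c' i' → c ≡ c' × i ≡ i'
    block-disjoint c c' i i' s∈ s∈' with ∈-tabulate⁻ s∈ | ∈-tabulate⁻ s∈'
    ... | l , refl | l' , eq = let c≡ , i≡ , _ = block-index {c} {c'} {i} {i'} {l} {l'} eq in c≡ , i≡
    X-disjoint : ∀ i i' {s} → s ∈ X i → s ∈ X i' → i ≡ i'
    X-disjoint i i' s∈ s∈' = proj₂ (block-disjoint fzero fzero i i' s∈ s∈')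
    Y-disjoint : ∀ i i' {s} → s ∈ Y i → s ∈ Y i' → i ≡ i'
    Y-disjoint i i' s∈ s∈' = proj₂ (block-disjoint (fsuc fzero) (fsuc fzero) i i' s∈ s∈')
    block! : ∀ c i → Unique (block c i)
    block! c i = Unique.tabulate⁺ λ {l} {l'} eq → proj₂ (proj₂ (block-index {c} {c} {i} {i} {l} {l'} eq))
    block∉Z : ∀ c i {s} → s ∈ block c i → s ∉ Z
    block∉Z c i s∈ with ∈-tabulate⁻ s∈
    ... | l , refl = pick∉Z fits (combine c (combine i l))
    length-block : ∀ c i → length (block c i) ≡ m
    length-block c i = length-tabulate (element c i)
    noMerge : ∀ ij → Bnd σ (NoMerge (X (proj₁ ij)) (Y (proj₂ ij)) R L) (g + 2) D
    noMerge (i , j) = Merging.merging (X i) (Y j) R D 14≤k g {ζ = ζ} M θ s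
      (conf-start (X i) (Y j) same (λ s∈ → s∈ , block∉Z fzero i s∈) (λ s∈ → s∈ , block∉Z (fsuc fzero) j s∈) (block! fzero i) (block! (fsuc fzero) j)
        (λ s∈ s∈' → case (proj₁ (block-disjoint fzero (fsuc fzero) i j s∈ s∈')) of λ ()) inv′)
      (trans (length-zipTasks (X i) (Y j) same) (length-block fzero i))
      (begin
        length (zipSeen (X i) (Y j) Z)        ≡⟨ length-zipSeen (X i) (Y j) Z same ⟩
        2 * length (X i) + length Z           ≡⟨ cong (λ l → 2 * l + length Z) (length-block fzero i) ⟩
        2 * m + length Z                      ≤⟨ +-monoʳ-≤ (2 * m) |Z|≤ ⟩
        2 * m + ζ                             ≤⟨ m≤m+n _ (12 * M) ⟩
        2 * m + ζ + 12 * M                    ≡⟨ lemma ζ M ⟩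
        ζ + 16 * M                            ∎)
      h≤n D≤ s+Tθ≤ D[n-θ]^s≤
      where
      open Start (X i) (Y j) R
      open ≤-Reasoning
      same : length (X i) ≡ length (Y j)
      same = trans (length-block fzero i) (sym (length-block (fsuc fzero) j))
      lemma : ∀ ζ M → 2 * (2 * M) + ζ + 12 * M ≡ ζ + 16 * M
      lemma = solve-∀
    Missed : Automaton n → Set
    Missed A = ∃ λ ((i , j) : Fin β × Fin β) → (i , j) ∈ is × NoMerge (X i) (Y j) R L A
    agree : ∀ {σ'} {A A' : Automaton n} {e} → A ⊨ σ' → A' ⊨ σ' → e ∈ keys σ' → δᵉ A' e ≡ δᵉ A e
    agree A⊨ A'⊨ e∈ with ∈-map⁻ proj₁ e∈
    ... | (e , v) , ev∈ , refl = trans (All.lookup A'⊨ ev∈) (sym (All.lookup A⊨ ev∈))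
    weaken : ∀ {σ' t} → (∀ {A} → A ⊨ σ' → A ⊨ σ) → Exploration.Valid [ x ] [ y ] [] σ ℓ t → Exploration.Valid [ x ] [ y ] [] σ' ℓ t
    weaken sub (Exploration.valid s x∈ y∈ p) = Exploration.valid s x∈ y∈ (p ∘ sub)

-- The first steps

swapHead : ∀ {A : Set} → A → List A → List A
swapHead x []       = x ∷ []
swapHead x (v ∷ ys) = v ∷ x ∷ ys

-- Serves to select the pending edge that is revealed next; positions count from 0.
toFront : ∀ {A : Set} → ℕ → List A → List A
toFront zero    xs       = xs
toFront (suc k) []       = []
toFront (suc k) (x ∷ xs) = swapHead x (toFront k xs)

toFront-↭ : ∀ {A : Set} k (xs : List A) → xs ↭ toFront k xs
toFront-↭ zero    xs       = ↭-refl
toFront-↭ (suc k) []       = ↭-refl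
toFront-↭ (suc k) (x ∷ xs) = ↭-trans (prep x (toFront-↭ k xs)) (swapHead-↭ (toFront k xs))
  where
  swapHead-↭ : ∀ ys → x ∷ ys ↭ swapHead x ys
  swapHead-↭ []       = ↭-refl
  swapHead-↭ (v ∷ ys) = Perm.shift v [ x ] ys

inv-front : ∀ {σ : Partial n} {Z E} k → Inv σ Z E → Inv σ Z (toFront k E)
inv-front {E = E} k = inv-↭ (toFront-↭ k E)

inv-take : ∀ {σ : Partial n} {Z E} k → Inv σ Z E → Inv σ Z (take k E)
inv-take {E = E} k inv = inv-drop++ (drop k E)
  (inv-↭ (↭-trans (↭-reflexive (sym (List.take++drop≡id k E))) (Perm.++-comm (take k E) (drop k E))) inv)

module Cost {n : ℕ} .{{_ : NonZero n}} (Q : Automaton n → Set) (N D : ℕ) .{{_ : NonZero D}} (d : ℕ) where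

  open Error Q N D

  -- The opening sees at most 10 states and hands at most 3 tasks to `explore`, which processes at
  -- most `work d 3` pairs. As `κ` dominates both `h` and the base in `ψ≤^`, it serves as a uniform
  -- price of a collision, and the coefficients `c` of the cases simply add up.
  h κ : ℕ
  h = 10 + 2 * work d 3
  κ = 2 * h * suc (work d 3)

  h≤κ : h ≤ κ
  h≤κ = ≤-trans (m≤n*m h 2) (m≤m*n (2 * h) (suc (work d 3)))

  record Cost (σ : Partial n) (j c : ℕ) : Set where
    constructor cost
    field
      toErr : Err σ j (c * κ ^ j)
  open Cost public

  cost-≤ : ∀ {σ j c c'} → c ≤ c' → Cost σ j c → Cost σ j c'
  cost-≤ {j = j} c≤c' (cost e) = cost (err-≤ (*-monoˡ-≤ (κ ^ j) c≤c') e)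

  cost-absurd : ∀ {σ j c} → (∀ {A} → A ⊨ σ → ¬ Q A) → Cost σ j c
  cost-absurd ¬Q = cost (mkErr (bnd-absurd ¬Q))

  cost-top : ∀ {σ Z E} → Inv σ Z E → Cost σ 0 1
  cost-top inv = cost (err-top (inv-keys inv))

  cost-reveal : ∀ {σ} e Z {j c c'} → length Z ≤ 10 → (∀ v → v ∈ Z → Cost ((e , v) ∷ σ) j c) → (∀ v → v ∉ Z → Cost ((e , v) ∷ σ) (suc j) c') →
    Cost σ (suc j) (c' + c)
  cost-reveal e Z {j} {c} {c'} |Z|≤ bad good = cost (err-≤ (begin
    c' * (κ * κ ^ j) + h * (c * κ ^ j)     ≤⟨ +-monoʳ-≤ (c' * (κ * κ ^ j)) (*-monoˡ-≤ (c * κ ^ j) h≤κ) ⟩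
    c' * (κ * κ ^ j) + κ * (c * κ ^ j)     ≡⟨ lemma c' c κ (κ ^ j) ⟩
    (c' + c) * (κ * κ ^ j)                 ∎)
    (err-branch e Z (≤-trans |Z|≤ (m≤m+n 10 (2 * work d 3))) (λ v v∈ → toErr (bad v v∈)) (λ v v∉ → toErr (good v v∉))))
    where
    open ≤-Reasoning
    lemma : ∀ c' c κ x → c' * (κ * x) + κ * (c * x) ≡ (c' + c) * (κ * x)
    lemma = solve-∀

-- Every case ends with more tasks than further collisions allowed for, so that these cannot remove all branches.
module Opening {n : ℕ} .{{_ : NonZero n}} (Q : Automaton n → Set) (N D : ℕ) .{{_ : NonZero D}} (d : ℕ)
  (noSink : ∀ {A} → Q A → ∀ s → δ A a s ≡ s → ¬ δ A b s ≡ s) where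

  open Cost Q N D d

  Finish : Fin n → Fin n → Set
  Finish x y = ∀ {σ Z ts} → Exploration.Conf [ x ] [ y ] [] (d + 2) σ Z ts → 2 ^ d * 1 ≤ length ts → length Z ≤ h → Bnd σ Q N D

  module _ (x y : Fin n) (finish : Finish x y) where

    open Exploration [ x ] [ y ] []

    -- Here `explore` is used with `M = 1`: `suc j` tasks still yield `2 ^ d` branches after `j`
    -- collisions.
    attempt : ∀ j {σ Z ts} → Conf 2 σ Z ts → suc j ≤ length ts → length ts ≤ 3 → length Z ≤ 10 → Cost σ (suc j) 1
    attempt j c j< ≤3 |Z|≤ = cost (Error.err-≤ Q N D
      (≤-trans (ψ≤^ h (work d 3) (suc j)) (≤-trans (^-monoˡ-≤ (suc j) (*-monoʳ-≤ (2 * h) (n≤1+n (work d 3)))) (≤-reflexive (sym (*-identityˡ _)))))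
      (explore Q N D h d j 1 3 c j< ≤3 |Z|≤ ≤-refl finish))

    start : ∀ {σ} → Valid σ 2 (task [] b x y)
    start = valid z≤n (here refl) (here refl) (λ _ → refl , refl)

    -- One collision has occurred: `a` takes `x` back to `x` or `y`, and takes `y` to `f`, a new
    -- state in the applications. If `x` goes to `y`, the word `aa` takes the pair to `f` and the
    -- image of `f` under `a`. If `a` fixes `x`, then `b` moves `x` because there is no sink, and
    -- unless the allowance runs out one of the words `b`, `ab`, `ba` leads to a pair whose next
    -- edges are unrevealed.
    looped : ∀ {σ Z z f} → (∀ {A} → A ⊨ σ → δ A a x ≡ z × δ A a y ≡ f) → z ≡ x ⊎ z ≡ y →
      Inv σ Z ((a , f) ∷ (b , f) ∷ (b , x) ∷ (b , y) ∷ []) → length Z ≤ 3 → (∀ {s} → s ∈ Z → s ≡ x ⊎ s ≡ y ⊎ s ≡ f) →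
      Cost σ 2 6
    looped {σ} {Z} {z} {f} at-a (inj₂ refl) inv |Z|≤3 _ = cost-≤ (m≤m+n 2 4)
      (cost-reveal (a , f) Z (≤-trans |Z|≤3 (m≤m+n 3 7))
        (λ g _ → attempt 0 (conf (inv-drop (inv-assign g inv)) (start ∷ [])) ≤-refl (m≤m+n 1 2) (≤-trans |Z|≤3 (m≤m+n 3 7)))
        (λ g g∉Z → attempt 1 {ts = task (a ∷ a ∷ []) b f g ∷ task [] b x y ∷ []}
          (conf (inv-front 1 (inv-drop (inv-open g∉Z (inv-assign g inv))))
            (valid ≤-refl (here refl) (here refl) (λ { {A} (fg ∷ A⊨σ) → let xz , yf = at-a A⊨σ in
               trans (cong (δ A a) xz) yf , trans (cong (δ A a) yf) fg }) ∷ start ∷ []))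
          ≤-refl (m≤m+n 2 1) (s≤s (≤-trans |Z|≤3 (m≤m+n 3 6)))))
    looped {σ} {Z} {z} {f} at-a (inj₁ refl) inv |Z|≤3 Z⊆ =
      cost-reveal (b , x) Z (≤-trans |Z|≤3 (m≤m+n 3 7)) bad good
      where
      inv₁ : ∀ p → Inv (((b , x) , p) ∷ σ) Z ((a , f) ∷ (b , f) ∷ (b , y) ∷ [])
      inv₁ p = inv-assign p (inv-front 2 inv)
      good : ∀ p → p ∉ Z → Cost (((b , x) , p) ∷ σ) 2 3
      good p p∉Z = cost-reveal (b , f) (p ∷ Z) (s≤s (≤-trans |Z|≤3 (m≤m+n 3 6)))
        -- The word `ab` has failed, and `b` is tried on the original pair.
        (λ g _ → let inv₃ = inv-assign g inv₂ in cost-reveal (b , y) (p ∷ Z) (s≤s (≤-trans |Z|≤3 (m≤m+n 3 6)))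
          (λ p' _ → cost-top (inv-assign p' (inv-front 3 inv₃)))
          (λ p' p'∉ → attempt 0 {ts = task (b ∷ []) a p p' ∷ []}
            (conf (inv-take 2 (inv-front 2 (inv-open p'∉ (inv-assign p' (inv-front 3 inv₃)))))
              (valid (s≤s z≤n) (here refl) (here refl) (λ { (yp' ∷ fg ∷ xp ∷ A⊨σ) → xp , yp' }) ∷ []))
            ≤-refl (m≤m+n 1 2) (s≤s (s≤s (≤-trans |Z|≤3 (m≤m+n 3 5))))))
        (λ g g∉ → attempt 1 {ts = children (a ∷ []) b p g}
          (conf (inv-take 4 (inv-front 3 (inv-front 2 (inv-front 3 (inv-front 1 (inv-open g∉ (inv-assign g inv₂)))))))
            (val ∷ val ∷ []))
          ≤-refl (m≤m+n 2 1) (s≤s (s≤s (≤-trans |Z|≤3 (m≤m+n 3 5)))))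
        where
        inv₂ : Inv (((b , x) , p) ∷ σ) (p ∷ Z) ((b , f) ∷ (a , p) ∷ (b , p) ∷ (a , f) ∷ (b , y) ∷ [])
        inv₂ = inv-front 3 (inv-open p∉Z (inv₁ p))
        val : ∀ {g c} → Valid (((b , f) , g) ∷ ((b , x) , p) ∷ σ) 2 (task (a ∷ b ∷ []) c p g)
        val = valid ≤-refl (here refl) (here refl) λ { {A} (fg ∷ xp ∷ A⊨σ) → let xx , yf = at-a A⊨σ in
          trans (cong (δ A b) xx) xp , trans (cong (δ A b) yf) fg }
      bad : ∀ p → p ∈ Z → Cost (((b , x) , p) ∷ σ) 1 3
      bad p p∈Z with Z⊆ p∈Z
      ... | inj₁ refl = cost-absurd λ { {A} (xx ∷ A⊨σ) q → noSink q x (proj₁ (at-a A⊨σ)) xx }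
      -- Here `b` takes `x` to `y`, so that `ba` takes `x` to `f`; the image of `y` under `ba` is
      -- revealed in two steps.
      ... | inj₂ (inj₁ refl) = cost-reveal (b , y) Z (≤-trans |Z|≤3 (m≤m+n 3 7))
        (λ f' _ → cost-top (inv-assign f' (inv-front 2 (inv₁ y))))
        (λ f' f'∉Z → let inv₂ = inv-open f'∉Z (inv-assign f' (inv-front 2 (inv₁ y))) in
          cost-reveal (a , f') (f' ∷ Z) (s≤s (≤-trans |Z|≤3 (m≤m+n 3 6)))
            (λ g _ → cost-top (inv-assign g inv₂))
            (λ g g∉ → attempt 0 {ts = task (b ∷ a ∷ []) a f g ∷ []}
              (conf (inv-take 2 (inv-front 3 (inv-open g∉ (inv-assign g inv₂))))
                (valid ≤-refl (here refl) (here refl) (λ { {A} (f'g ∷ yf' ∷ xy ∷ A⊨σ) →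
                   trans (cong (δ A a) xy) (proj₂ (at-a A⊨σ)) , trans (cong (δ A a) yf') f'g }) ∷ []))
              ≤-refl (m≤m+n 1 2) (s≤s (s≤s (≤-trans |Z|≤3 (m≤m+n 3 5))))))
      ... | inj₂ (inj₂ refl) = cost-≤ (m≤m+n 2 1) (cost-reveal (b , y) Z (≤-trans |Z|≤3 (m≤m+n 3 7))
        (λ p' _ → cost-top (inv-assign p' (inv-front 2 (inv₁ f))))
        (λ p' p'∉Z → attempt 0 {ts = task (b ∷ []) a f p' ∷ []}
          (conf (inv-take 2 (inv-front 2 (inv-open p'∉Z (inv-assign p' (inv-front 2 (inv₁ f))))))
            (valid (s≤s z≤n) (here refl) (here refl) (λ { (yp' ∷ xf ∷ A⊨σ) → xf , yp' }) ∷ []))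
          ≤-refl (m≤m+n 1 2) (s≤s (≤-trans |Z|≤3 (m≤m+n 3 6)))))

  -- The letter `a` is read first. Without a collision there are three tasks: the two after `a` and
  -- the pair itself with next letter `b`. A collision of one value leads to `looped`, with `x` and
  -- `y` exchanged if it is the value at `y`, which is why both orders of `Finish` occur. If both
  -- collide, only the task with letter `b` is left, against one last collision.
  opening : ∀ x y → x ≢ y → Finish x y → Finish y x → (∀ {A} → Q A → δ A a x ≢ δ A a y) → Cost [] 3 14
  opening x y x≢y finish finish′ a-separates = cost-reveal (a , x) Z (m≤m+n 2 8) bad good
    where
    open Exploration [ x ] [ y ] []
    Z = x ∷ y ∷ []
    inv₀ : Inv [] Z ((a , x) ∷ (a , y) ∷ (b , x) ∷ (b , y) ∷ [])
    inv₀ = mkInv (((x≢y ∘ cong proj₂) ∷ (λ ()) ∷ (λ ()) ∷ []) ∷ ((λ ()) ∷ (λ ()) ∷ []) ∷ ((x≢y ∘ cong proj₂) ∷ []) ∷ [] ∷ [])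
                 (here refl ∷ there (here refl) ∷ here refl ∷ there (here refl) ∷ [])
    bad : ∀ p → p ∈ Z → Cost (((a , x) , p) ∷ []) 2 7
    bad p p∈Z = cost-reveal (a , y) Z (m≤m+n 2 8)
      (λ p' _ → attempt x y finish 0 (conf (inv-assign p' (inv-assign p inv₀)) (start x y finish ∷ [])) ≤-refl (m≤m+n 1 2) (m≤m+n 2 8))
      (λ p' p'∉Z → looped x y finish (λ { (yp' ∷ xp ∷ []) → xp , yp' }) (loop p∈Z)
        (inv-open p'∉Z (inv-assign p' (inv-assign p inv₀))) ≤-refl
        λ { (here refl) → inj₂ (inj₂ refl) ; (there (here refl)) → inj₁ refl ; (there (there (here refl))) → inj₂ (inj₁ refl) })
      where
      loop : ∀ {s} → s ∈ Z → s ≡ x ⊎ s ≡ y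
      loop (here refl)         = inj₁ refl
      loop (there (here refl)) = inj₂ refl
    good : ∀ p → p ∉ Z → Cost (((a , x) , p) ∷ []) 3 7
    good p p∉Z = cost-reveal (a , y) (p ∷ Z) (m≤m+n 3 7) collision
      (λ p' p'∉ → attempt x y finish 2 {ts = task [] b x y ∷ children [] a p p'}
        (conf (inv-front 5 (inv-front 5 (inv-front 3 (inv-front 2 (inv-front 3 (inv-front 1 (inv-open p'∉ (inv-assign p' inv₂))))))))
          (start x y finish ∷ val ∷ val ∷ []))
        ≤-refl ≤-refl (m≤m+n 4 6))
      where
      inv₂ : Inv (((a , x) , p) ∷ []) (p ∷ Z) ((a , y) ∷ (a , p) ∷ (b , p) ∷ (b , x) ∷ (b , y) ∷ [])
      inv₂ = inv-front 2 (inv-open p∉Z (inv-assign p inv₀))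
      val : ∀ {p' c} → Valid (((a , y) , p') ∷ ((a , x) , p) ∷ []) 2 (task (a ∷ []) c p p')
      val = valid (s≤s z≤n) (here refl) (here refl) λ { (yp' ∷ xp ∷ []) → xp , yp' }
      inv₃ : ∀ p' → Inv (((a , y) , p') ∷ ((a , x) , p) ∷ []) (p ∷ Z) ((a , p) ∷ (b , p) ∷ (b , y) ∷ (b , x) ∷ [])
      inv₃ p' = inv-front 3 (inv-front 3 (inv-front 3 (inv-front 2 (inv-assign p' inv₂))))
      elim : ∀ {s} → s ∈ p ∷ Z → s ≡ y ⊎ s ≡ x ⊎ s ≡ p
      elim (here refl)                 = inj₂ (inj₂ refl)
      elim (there (here refl))         = inj₂ (inj₁ refl)
      elim (there (there (here refl))) = inj₁ refl
      collision : ∀ p' → p' ∈ p ∷ Z → Cost (((a , y) , p') ∷ ((a , x) , p) ∷ []) 2 6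
      collision p' p'∈ with elim p'∈
      ... | inj₂ (inj₂ refl) = cost-absurd λ { (yp ∷ xp ∷ []) q → a-separates q (trans xp (sym yp)) }
      ... | inj₁ refl = looped y x finish′ (λ { (yp' ∷ xp ∷ []) → yp' , xp }) (inj₁ refl) (inv₃ p') ≤-refl elim
      ... | inj₂ (inj₁ refl) = looped y x finish′ (λ { (yp' ∷ xp ∷ []) → yp' , xp }) (inj₂ refl) (inv₃ p') ≤-refl elim

-- Numerical estimates

bernoulli : ∀ z y m → z ^ suc m + suc m * (y * z ^ m) ≤ (z + y) ^ suc m
bernoulli z y zero    = ≤-reflexive (lemma z y)
  where
  lemma : ∀ z y → z * 1 + 1 * (y * 1) ≡ (z + y) * 1
  lemma = solve-∀
bernoulli z y (suc m) = begin
  z * (z * x) + suc (suc m) * (y * (z * x))                             ≤⟨ m≤m+n _ (suc m * (y * (y * x))) ⟩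
  z * (z * x) + suc (suc m) * (y * (z * x)) + suc m * (y * (y * x))      ≡⟨ lemma z y x m ⟩
  (z + y) * (z * x + suc m * (y * x))                                    ≤⟨ *-monoʳ-≤ (z + y) (bernoulli z y m) ⟩
  (z + y) * (z + y) ^ suc m                                              ∎
  where
  open ≤-Reasoning
  x = z ^ m
  lemma : ∀ z y x m → z * (z * x) + suc (suc m) * (y * (z * x)) + suc m * (y * (y * x)) ≡ (z + y) * (z * x + suc m * (y * x))
  lemma = solve-∀

-- With `z = x ∸ y`, each of the first two terms of the binomial expansion of `(z + y) ^ suc m` is
-- at least `z ^ suc m`.
halve : ∀ {x y} m → x ≤ suc m * y → 2 * (x ∸ y) ^ suc m ≤ x ^ suc m
halve {x} {y} m x≤ with ≤-total y x
... | inj₂ x≤y = ≤-trans (≤-reflexive (cong (λ z → 2 * z ^ suc m) (m≤n⇒m∸n≡0 x≤y))) z≤n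
... | inj₁ y≤x = begin
  2 * (z * z ^ m)                           ≡⟨ lemma (z * z ^ m) ⟩
  z * z ^ m + z * z ^ m                     ≤⟨ +-monoʳ-≤ (z * z ^ m) (*-monoˡ-≤ (z ^ m) (≤-trans (m∸n≤m x y) x≤)) ⟩
  z * z ^ m + suc m * y * z ^ m             ≡⟨ cong (z * z ^ m +_) (*-assoc (suc m) y (z ^ m)) ⟩
  z * z ^ m + suc m * (y * z ^ m)           ≤⟨ bernoulli z y m ⟩
  (z + y) ^ suc m                           ≡⟨ cong (_^ suc m) (m∸n+n≡m y≤x) ⟩
  x ^ suc m                                 ∎
  where
  open ≤-Reasoning
  z = x ∸ y
  lemma : ∀ a → 2 * a ≡ a + a
  lemma = solve-∀

-- These are `f` halvings by `m` factors each.
decay : ∀ {x y D} m .{{_ : NonZero m}} f s → x ≤ m * y → m * f ≤ s → D ≤ 2 ^ f → D * (x ∸ y) ^ s ≤ x ^ s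
decay {x} {y} {D} (suc m) f s x≤ mf≤s D≤ = ^-mono-exp {D = D} (m∸n≤m x y) mf≤s (begin
  D * (x ∸ y) ^ (suc m * f)           ≤⟨ *-monoˡ-≤ _ D≤ ⟩
  2 ^ f * (x ∸ y) ^ (suc m * f)       ≡⟨ cong (2 ^ f *_) (^-*-assoc (x ∸ y) (suc m) f) ⟨
  2 ^ f * ((x ∸ y) ^ suc m) ^ f       ≡⟨ ^-distribʳ-* 2 ((x ∸ y) ^ suc m) f ⟨
  (2 * (x ∸ y) ^ suc m) ^ f           ≤⟨ ^-monoˡ-≤ f (halve m x≤) ⟩
  (x ^ suc m) ^ f                     ≡⟨ ^-*-assoc x (suc m) f ⟩
  x ^ (suc m * f)                     ∎)
  where open ≤-Reasoning

work-total : ∀ d U → work d U + U ≡ U * 2 ^ d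
work-total zero    U = sym (*-identityʳ U)
work-total (suc d) U = trans (lemma₁ U (work d (2 * U))) (trans (work-total d (2 * U)) (lemma₂ U (2 ^ d)))
  where
  lemma₁ : ∀ U w → U + w + U ≡ w + 2 * U
  lemma₁ = solve-∀
  lemma₂ : ∀ U x → 2 * U * x ≡ U * (2 * x)
  lemma₂ = solve-∀

m<2^m : ∀ m → m < 2 ^ m
m<2^m zero    = s≤s z≤n
m<2^m (suc m) = ≤-trans (s≤s (m<2^m m)) (≤-trans (+-monoˡ-≤ (2 ^ m) (m^n>0 2 m)) (≤-reflexive (cong (2 ^ m +_) (sym (+-identityʳ (2 ^ m))))))

-- The failure probability aimed at is `1 / 2 ^ p`. By `big`, `2 ^ p` halvings outweigh `n ^ 6`, and
-- `p + 100 ≤ q` makes room for that many in `collisions` and `hits`.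
module Parameters (n q p k : ℕ) (p+100≤q : p + 100 ≤ q) (14≤k : 14 ≤ k)
  (lo : 2 ^ (12 * q + (16 + k)) ≤ n) (hi : n ≤ 2 ^ (12 * q + 42)) (big : 6 * (12 * q + 42) ≤ 2 ^ p) where

  open ≤-Reasoning

  -- `D` is chosen so that the `n ^ 2` pairs of states with errors `N / D`, where `N ≤ n ^ 3`,
  -- contribute at most `1 / n`. `U` is the number `u`, and `X` is `u ^ 11`.
  D U X : ℕ
  D = n ^ 6
  U = 2 ^ q
  X = 2 ^ (11 * q)

  pow : ∀ {i j} → i ≤ j → 2 ^ i ≤ 2 ^ j
  pow = ^-monoʳ-≤ 2

  _·_ : ∀ i j → 2 ^ i * 2 ^ j ≡ 2 ^ (i + j)
  i · j = sym (^-distribˡ-+-* 2 i j)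

  p≤q : p ≤ q
  p≤q = ≤-trans (m≤m+n p 100) p+100≤q

  q≥100 : 100 ≤ q
  q≥100 = ≤-trans (m≤n+m 100 p) p+100≤q

  1≤X : 1 ≤ X
  1≤X = m^n>0 2 (11 * q)

  2^≤n : ∀ i → i ≤ 12 * q + (16 + k) → 2 ^ i ≤ n
  2^≤n i i≤ = ≤-trans (pow i≤) lo

  capacity : ∀ {Y} → Y ≤ 2 ^ (11 * q + 11) → 4 * (2 ^ k * Y) ≤ n
  capacity {Y} Y≤ = begin
    4 * (2 ^ k * Y)                        ≤⟨ *-monoʳ-≤ 4 (*-monoʳ-≤ (2 ^ k) Y≤) ⟩
    2 ^ 2 * (2 ^ k * 2 ^ (11 * q + 11))    ≡⟨ cong (2 ^ 2 *_) (k · (11 * q + 11)) ⟩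
    2 ^ 2 * 2 ^ (k + (11 * q + 11))        ≡⟨ 2 · (k + (11 * q + 11)) ⟩
    2 ^ (2 + (k + (11 * q + 11)))          ≤⟨ 2^≤n (2 + (k + (11 * q + 11))) (≤-trans (m≤m+n _ (3 + q)) (≤-reflexive (lemma k q))) ⟩
    n                                      ∎
    where
    lemma : ∀ k q → 2 + (k + (11 * q + 11)) + (3 + q) ≡ 12 * q + (16 + k)
    lemma = solve-∀

  4^ : ∀ g j → 4 ^ g * 2 ^ j ≡ 2 ^ (2 * g + j)
  4^ g j = trans (cong (_* 2 ^ j) (^-*-assoc 2 2 g)) ((2 * g) · j)

  size₁ : 4 ^ (5 * q) * U ≡ X
  size₁ = trans (4^ (5 * q) q) (cong (2 ^_) (lemma q))
    where
    lemma : ∀ q → 2 * (5 * q) + q ≡ 11 * q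
    lemma = solve-∀

  size₂ : 4 ^ (3 * q) * 2 ^ (5 * q + 4) ≡ X * 2 ^ 4
  size₂ = trans (4^ (3 * q) (5 * q + 4)) (trans (cong (2 ^_) (lemma q)) (sym ((11 * q) · 4)))
    where
    lemma : ∀ q → 2 * (3 * q) + (5 * q + 4) ≡ 11 * q + 4
    lemma = solve-∀

  ζ : ℕ
  ζ = 10 + 16 * (4 ^ (5 * q) * U)

  X*≤ : ∀ {c} → c ≤ 2 ^ 11 → X * c ≤ 2 ^ (11 * q + 11)
  X*≤ c≤ = ≤-trans (*-monoʳ-≤ X c≤) (≤-reflexive ((11 * q) · 11))

  10≤ : 10 ≤ X * 10
  10≤ = m≤n*m 10 X {{>-nonZero 1≤X}}

  ζ≤ : ζ ≤ X * 26
  ζ≤ = begin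
    10 + 16 * (4 ^ (5 * q) * U)   ≡⟨ cong (λ x → 10 + 16 * x) size₁ ⟩
    10 + 16 * X                   ≤⟨ +-monoˡ-≤ (16 * X) 10≤ ⟩
    X * 10 + 16 * X               ≡⟨ lemma X ⟩
    X * 26                        ∎
    where
    lemma : ∀ x → x * 10 + 16 * x ≡ x * 26
    lemma = solve-∀

  capacity₁ : 4 * (2 ^ k * (10 + 64 * (4 ^ (5 * q) * U))) ≤ n
  capacity₁ = capacity (begin
    10 + 64 * (4 ^ (5 * q) * U)   ≡⟨ cong (λ x → 10 + 64 * x) size₁ ⟩
    10 + 64 * X                   ≤⟨ +-monoˡ-≤ (64 * X) 10≤ ⟩
    X * 10 + 64 * X               ≡⟨ lemma X ⟩
    X * 74                        ≤⟨ X*≤ (≤ᵇ⇒≤ 74 (2 ^ 11) tt) ⟩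
    2 ^ (11 * q + 11)             ∎)
    where
    lemma : ∀ x → x * 10 + 64 * x ≡ x * 74
    lemma = solve-∀

  capacity₂ : 4 * (2 ^ k * (ζ + 64 * (4 ^ (3 * q) * 2 ^ (5 * q + 4)))) ≤ n
  capacity₂ = capacity (begin
    ζ + 64 * (4 ^ (3 * q) * 2 ^ (5 * q + 4))   ≤⟨ +-mono-≤ ζ≤ (≤-reflexive (trans (cong (64 *_) size₂) (lemma₁ 64 X (2 ^ 4)))) ⟩
    X * 26 + X * (64 * 2 ^ 4)                  ≡⟨ *-distribˡ-+ X 26 (64 * 2 ^ 4) ⟨
    X * (26 + 64 * 2 ^ 4)                      ≤⟨ X*≤ (≤ᵇ⇒≤ (26 + 64 * 2 ^ 4) (2 ^ 11) tt) ⟩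
    2 ^ (11 * q + 11)                          ∎)
    where
    lemma₁ : ∀ c x y → c * (x * y) ≡ x * (c * y)
    lemma₁ = solve-∀

  D≤2^2^p : D ≤ 2 ^ 2 ^ p
  D≤2^2^p = begin
    n ^ 6                        ≤⟨ ^-monoˡ-≤ 6 hi ⟩
    (2 ^ (12 * q + 42)) ^ 6      ≡⟨ ^-*-assoc 2 (12 * q + 42) 6 ⟩
    2 ^ ((12 * q + 42) * 6)      ≡⟨ cong (2 ^_) (*-comm (12 * q + 42) 6) ⟩
    2 ^ (6 * (12 * q + 42))      ≤⟨ pow big ⟩
    2 ^ 2 ^ p                    ∎

  D≤ : ∀ {j} → p ≤ j → D ≤ 2 ^ suc (2 ^ j)
  D≤ p≤j = ≤-trans D≤2^2^p (pow (≤-trans (pow p≤j) (n≤1+n _)))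

  -- The rare words account for at most `4 * X` pairs. The 4 in `5 * q + 4` raises the number of
  -- available pairs to `16 * X`, so that `X` popular ones are certainly left.
  sparse : X + 2 ^ (2 + 3 * (3 * q)) * 2 ^ (2 * q) ≤ 4 ^ (3 * q) * 2 ^ (5 * q + 4)
  sparse = begin
    X + 2 ^ (2 + 3 * (3 * q)) * 2 ^ (2 * q)    ≡⟨ cong (X +_) (trans ((2 + 3 * (3 * q)) · (2 * q)) (trans (cong (2 ^_) (lemma q)) (sym ((11 * q) · 2)))) ⟩
    X + X * 2 ^ 2                              ≡⟨ cong (_+ X * 2 ^ 2) (*-identityʳ X) ⟨
    X * 1 + X * 2 ^ 2                          ≡⟨ *-distribˡ-+ X 1 (2 ^ 2) ⟨
    X * (1 + 2 ^ 2)                            ≤⟨ *-monoʳ-≤ X (≤ᵇ⇒≤ (1 + 2 ^ 2) (2 ^ 4) tt) ⟩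
    X * 2 ^ 4                                  ≡⟨ size₂ ⟨
    4 ^ (3 * q) * 2 ^ (5 * q + 4)              ∎
    where
    lemma : ∀ q → 2 + 3 * (3 * q) + 2 * q ≡ 11 * q + 2
    lemma = solve-∀

  10q+p+100≤11q : 10 * q + (p + 100) ≤ 11 * q
  10q+p+100≤11q = ≤-trans (+-monoʳ-≤ (10 * q) p+100≤q) (≤-reflexive (+-comm (10 * q) q))

  -- As `n` is at most `2 ^ (10 * q + 42)` times `2 ^ (2 * q)`, a halving takes `2 ^ (10 * q + 42)`
  -- trials, and `X` trials suffice for `2 ^ p` halvings.
  collisions : D * (n ∸ 2 ^ (2 * q)) ^ X ≤ n ^ X
  collisions = decay (2 ^ (10 * q + 42)) {{m^n≢0 2 (10 * q + 42)}} (2 ^ p) X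
    (≤-trans hi (≤-reflexive (sym (trans ((10 * q + 42) · (2 * q)) (cong (2 ^_) (lemma q))))))
    (≤-trans (≤-reflexive ((10 * q + 42) · p)) (pow (≤-trans (≤-trans (≤-reflexive (+-assoc (10 * q) 42 p))
      (+-monoʳ-≤ (10 * q) (≤-trans (≤-reflexive (+-comm 42 p)) (+-monoʳ-≤ p (m≤m+n 42 58))))) 10q+p+100≤11q)))
    D≤2^2^p
    where
    lemma : ∀ q → 10 * q + 42 + 2 * q ≡ 12 * q + 42
    lemma = solve-∀

  β : ℕ
  β = 2 ^ (7 * q)

  -- Here a halving takes `2 ^ (10 * q + 84)` trials; the 84 is covered by the margin in
  -- `p + 100 ≤ q`.
  hits : D * (n * n ∸ β * β) ^ (2 * (4 ^ (5 * q) * U)) ≤ (n * n) ^ (2 * (4 ^ (5 * q) * U))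
  hits = decay (2 ^ (10 * q + 84)) {{m^n≢0 2 (10 * q + 84)}} (2 ^ p) (2 * (4 ^ (5 * q) * U))
    (≤-trans (*-mono-≤ hi hi) (≤-reflexive (trans ((12 * q + 42) · (12 * q + 42))
      (trans (cong (2 ^_) (lemma q)) (sym (trans (cong (2 ^ (10 * q + 84) *_) ((7 * q) · (7 * q))) ((10 * q + 84) · (7 * q + 7 * q))))))))
    (begin
      2 ^ (10 * q + 84) * 2 ^ p     ≡⟨ (10 * q + 84) · p ⟩
      2 ^ (10 * q + 84 + p)         ≤⟨ pow (≤-trans (≤-trans (≤-reflexive (+-assoc (10 * q) 84 p)) (+-monoʳ-≤ (10 * q) (≤-trans (≤-reflexive (+-comm 84 p)) (+-monoʳ-≤ p (m≤m+n 84 16))))) 10q+p+100≤11q) ⟩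
      X                             ≡⟨ size₁ ⟨
      4 ^ (5 * q) * U               ≤⟨ m≤n*m _ 2 ⟩
      2 * (4 ^ (5 * q) * U)         ∎)
    D≤2^2^p
    where
    lemma : ∀ q → 12 * q + 42 + (12 * q + 42) ≡ 10 * q + 84 + (7 * q + 7 * q)
    lemma = solve-∀

  blocks : 2 * (β * (2 * 2 ^ (5 * q + 4))) + ζ ≤ n
  blocks = begin
    2 * (β * (2 * 2 ^ (5 * q + 4))) + ζ       ≤⟨ +-mono-≤ (≤-reflexive eq) (≤-trans ζ≤ (≤-trans (*-monoʳ-≤ X (≤ᵇ⇒≤ 26 (2 ^ 6) tt)) (≤-trans (≤-reflexive ((11 * q) · 6)) (pow (+-monoˡ-≤ 6 (*-monoˡ-≤ q (m≤m+n 11 1))))))) ⟩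
    2 ^ (12 * q + 6) + 2 ^ (12 * q + 6)       ≡⟨ lemma₁ (2 ^ (12 * q + 6)) ⟩
    2 ^ suc (12 * q + 6)                      ≤⟨ 2^≤n _ (≤-trans (≤-reflexive (sym (+-suc (12 * q) 6))) (+-monoʳ-≤ (12 * q) (≤-trans (m≤m+n 7 9) (m≤m+n 16 k)))) ⟩
    n                                         ∎
    where
    lemma₁ : ∀ x → x + x ≡ 2 * x
    lemma₁ = solve-∀
    lemma₂ : ∀ x y → 2 * (x * (2 * y)) ≡ 4 * (x * y)
    lemma₂ = solve-∀
    lemma₃ : ∀ q → 2 + (7 * q + (5 * q + 4)) ≡ 12 * q + 6
    lemma₃ = solve-∀
    eq : 2 * (β * (2 * 2 ^ (5 * q + 4))) ≡ 2 ^ (12 * q + 6)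
    eq = trans (lemma₂ β (2 ^ (5 * q + 4))) (trans (cong (2 ^ 2 *_) ((7 * q) · (5 * q + 4))) (trans (2 · (7 * q + (5 * q + 4))) (cong (2 ^_) (lemma₃ q))))

  -- The word consists of at most 2 letters of the opening, `suc q` of the slow growth, `15 * q` of
  -- the fast growth, 1 for the step into a mergeable pair and `9 * q + 1` for merging it, in all
  -- `25 * q + 5`. The bound `3 * log₂ n` is at least `36 * q`.
  length≤ : suc (3 * (5 * q) + (suc q + 2)) + suc (3 * (3 * q)) ≤ ⌊3log₂ n ⌋
  length≤ = begin
    suc (3 * (5 * q) + (suc q + 2)) + suc (3 * (3 * q))   ≡⟨ lemma q ⟩
    25 * q + 5                                            ≤⟨ +-monoʳ-≤ (25 * q) (≤-trans (≤-trans (m≤m+n 5 95) q≥100) (m≤n*m q 11)) ⟩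
    25 * q + 11 * q                                       ≡⟨ lemma′ q ⟩
    12 * q * 3                                            ≡⟨ ⌊log₂[2^n]⌋≡n (12 * q * 3) ⟨
    ⌊log₂ (2 ^ (12 * q * 3)) ⌋                            ≡⟨ cong ⌊log₂_⌋ (^-*-assoc 2 (12 * q) 3) ⟨
    ⌊log₂ ((2 ^ (12 * q)) ^ 3) ⌋                          ≤⟨ ⌊log₂⌋-mono-≤ (^-monoˡ-≤ 3 (2^≤n (12 * q) (m≤m+n (12 * q) _))) ⟩
    ⌊log₂ (n ^ 3) ⌋                                       ∎
    where
    lemma : ∀ q → suc (3 * (5 * q) + (suc q + 2)) + suc (3 * (3 * q)) ≡ 25 * q + 5
    lemma = solve-∀
    lemma′ : ∀ q → 25 * q + 11 * q ≡ 12 * q * 3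
    lemma′ = solve-∀

  2*work≤ : 2 * work (suc q) 3 ≤ 12 * U
  2*work≤ = begin
    2 * work (suc q) 3        ≤⟨ *-monoʳ-≤ 2 (≤-trans (m≤m+n (work (suc q) 3) 3) (≤-reflexive (work-total (suc q) 3))) ⟩
    2 * (3 * (2 * U))         ≡⟨ lemma U ⟩
    12 * U                    ∎
    where
    lemma : ∀ x → 2 * (3 * (2 * x)) ≡ 12 * x
    lemma = solve-∀

  1≤U : 1 ≤ U
  1≤U = m^n>0 2 q

  -- `h` and `κ` agree with those of `Cost` for `d = suc q`. In `N`, the term `5 * q` comes from
  -- `grow` and the rest from `leaves`.
  h κ N : ℕ
  h = 10 + 2 * work (suc q) 3
  κ = 2 * h * suc (work (suc q) 3)
  N = 5 * q + (β * β * (3 * q + 2) + 1)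

  h≤ : h ≤ 10 + 16 * U
  h≤ = +-monoʳ-≤ 10 (≤-trans 2*work≤ (*-monoˡ-≤ U (m≤m+n 12 4)))

  κ≤ : κ ≤ 2 ^ (q + q + 9)
  κ≤ = begin
    2 * h * suc (work (suc q) 3)
      ≤⟨ *-mono-≤ (*-monoʳ-≤ 2 h≤′) w≤ ⟩
    2 * (U * 26) * (U * 7)
      ≡⟨ lemma U ⟩
    U * U * 364
      ≤⟨ *-monoʳ-≤ (U * U) (≤ᵇ⇒≤ 364 (2 ^ 9) tt) ⟩
    U * U * 2 ^ 9
      ≡⟨ trans (cong (_* 2 ^ 9) (q · q)) ((q + q) · 9) ⟩
    2 ^ (q + q + 9) ∎
    where
    lemma : ∀ x → 2 * (x * 26) * (x * 7) ≡ x * x * 364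
    lemma = solve-∀
    10+16U : ∀ x → x * 10 + 16 * x ≡ x * 26
    10+16U = solve-∀
    h≤′ : h ≤ U * 26
    h≤′ = ≤-trans h≤ (≤-trans (+-monoˡ-≤ (16 * U) (m≤n*m 10 U {{>-nonZero 1≤U}})) (≤-reflexive (10+16U U)))
    w≤ : suc (work (suc q) 3) ≤ U * 7
    w≤ = begin
      suc (work (suc q) 3)     ≤⟨ s≤s (*-cancelˡ-≤ 2 (≤-trans 2*work≤ (≤-reflexive (12U U)))) ⟩
      1 + U * 6                ≤⟨ +-monoˡ-≤ (U * 6) 1≤U ⟩
      U + U * 6                ≡⟨ 7U U ⟩
      U * 7                    ∎
      where
      12U : ∀ x → 12 * x ≡ 2 * (x * 6)
      12U = solve-∀
      7U : ∀ x → x + x * 6 ≡ x * 7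
      7U = solve-∀

  -- As `κ` is of order `u ^ 2`, the left side is at most of order `u ^ 7`. Three collisions thus
  -- suffice against the sum over `n ^ 2` pairs.
  opening≤ : 4 * (2 ^ p * (14 * κ ^ 3)) ≤ n
  opening≤ = begin
    4 * (2 ^ p * (14 * κ ^ 3))
      ≤⟨ *-monoʳ-≤ 4 (*-mono-≤ (pow p≤q) (*-mono-≤ (≤ᵇ⇒≤ 14 (2 ^ 4) tt) (^-monoˡ-≤ 3 κ≤))) ⟩
    2 ^ 2 * (U * (2 ^ 4 * (2 ^ (q + q + 9)) ^ 3))
      ≡⟨ cong (λ x → 2 ^ 2 * (U * (2 ^ 4 * x))) (^-*-assoc 2 (q + q + 9) 3) ⟩
    2 ^ 2 * (U * (2 ^ 4 * 2 ^ ((q + q + 9) * 3)))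
      ≡⟨ cong (λ x → 2 ^ 2 * (U * x)) (4 · ((q + q + 9) * 3)) ⟩
    2 ^ 2 * (U * 2 ^ (4 + (q + q + 9) * 3))
      ≡⟨ cong (2 ^ 2 *_) (q · (4 + (q + q + 9) * 3)) ⟩
    2 ^ 2 * 2 ^ (q + (4 + (q + q + 9) * 3))
      ≡⟨ 2 · (q + (4 + (q + q + 9) * 3)) ⟩
    2 ^ (2 + (q + (4 + (q + q + 9) * 3)))
      ≤⟨ 2^≤n _ (begin
        2 + (q + (4 + (q + q + 9) * 3))     ≡⟨ lemma q ⟩
        7 * q + 33                          ≤⟨ +-monoʳ-≤ (7 * q) (≤-trans (≤-trans (m≤m+n 33 67) q≥100) (m≤n*m q 5)) ⟩
        7 * q + 5 * q                       ≡⟨ lemma′ q ⟩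
        12 * q                              ≤⟨ m≤m+n (12 * q) _ ⟩
        12 * q + (16 + k)                   ∎) ⟩
    n ∎
    where
    lemma : ∀ q → 2 + (q + (4 + (q + q + 9) * 3)) ≡ 7 * q + 33
    lemma = solve-∀
    lemma′ : ∀ q → 7 * q + 5 * q ≡ 12 * q
    lemma′ = solve-∀

  4*2^p≤n : 4 * 2 ^ p ≤ n
  4*2^p≤n = ≤-trans (≤-reflexive (2 · p)) (2^≤n (2 + p) (begin
    2 + p                    ≤⟨ +-mono-≤ (≤-trans (m≤m+n 2 14) (m≤m+n 16 k)) p≤q ⟩
    16 + k + q               ≡⟨ +-comm (16 + k) q ⟩
    q + (16 + k)             ≤⟨ +-monoˡ-≤ (16 + k) (m≤n*m q 12) ⟩
    12 * q + (16 + k)        ∎))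

  N≤n^3 : N ≤ n ^ 3
  N≤n^3 = begin
    5 * q + (β * β * (3 * q + 2) + 1)                ≡⟨ lemma₁ (5 * q) (β * β * (3 * q + 2)) ⟩
    β * β * (3 * q + 2) + (5 * q + 1)                ≤⟨ +-monoʳ-≤ (β * β * (3 * q + 2)) (m≤n*m (5 * q + 1) (β * β) {{m*n≢0 β β {{m^n≢0 2 (7 * q)}} {{m^n≢0 2 (7 * q)}}}}) ⟩
    β * β * (3 * q + 2) + β * β * (5 * q + 1)        ≡⟨ lemma₂ (β * β) q ⟩
    β * β * (8 * q + 3)                              ≤⟨ *-mono-≤ (*-mono-≤ β≤n β≤n) 8q+3≤n ⟩
    n * n * n                                        ≡⟨ lemma₃ n ⟩
    n ^ 3                                            ∎
    where
    lemma₁ : ∀ x y → x + (y + 1) ≡ y + (x + 1)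
    lemma₁ = solve-∀
    lemma₂ : ∀ x q → x * (3 * q + 2) + x * (5 * q + 1) ≡ x * (8 * q + 3)
    lemma₂ = solve-∀
    lemma₃ : ∀ n → n * n * n ≡ n * (n * (n * 1))
    lemma₃ = solve-∀
    lemma₄ : ∀ x → 8 * x + 8 * x ≡ x * 16
    lemma₄ = solve-∀
    β≤n : β ≤ n
    β≤n = 2^≤n (7 * q) (≤-trans (*-monoˡ-≤ q (m≤m+n 7 5)) (m≤m+n (12 * q) _))
    8q+3≤n : 8 * q + 3 ≤ n
    8q+3≤n = begin
      8 * q + 3              ≤⟨ +-mono-≤ (*-monoʳ-≤ 8 (<⇒≤ (m<2^m q))) (≤-trans (m≤m+n 3 5) (m≤m*n 8 U {{m^n≢0 2 q}})) ⟩
      8 * U + 8 * U          ≡⟨ lemma₄ U ⟩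
      U * 2 ^ 4              ≡⟨ q · 4 ⟩
      2 ^ (q + 4)            ≤⟨ 2^≤n (q + 4) (+-mono-≤ (m≤n*m q 12) (≤-trans (m≤m+n 4 12) (m≤m+n 16 k))) ⟩
      n                      ∎

  -- 1 / n for the sinks and the bound of the opening and of the rest of the exploration for n ^ 2 pairs.
  total : 2 ^ p * (n * (D * n) + n * n * (N * n ^ 3 + D * (14 * κ ^ 3))) ≤ D * n ^ 3
  total = *-cancelˡ-≤ 4 (begin
    4 * (2 ^ p * (n * (D * n) + n * n * (N * n ^ 3 + D * (14 * κ ^ 3))))
      ≡⟨ lemma₁ (2 ^ p) n D N (n ^ 3) (14 * κ ^ 3) ⟩
    4 * 2 ^ p * (D * (n * n) + n * n * (n ^ 3 * N)) + 4 * (2 ^ p * (14 * κ ^ 3)) * (D * (n * n))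
      ≤⟨ +-mono-≤ (*-mono-≤ 4*2^p≤n (+-monoʳ-≤ (D * (n * n)) (*-monoʳ-≤ (n * n) (*-monoʳ-≤ (n ^ 3) N≤n^3)))) (*-monoˡ-≤ (D * (n * n)) opening≤) ⟩
    n * (D * (n * n) + n * n * (n ^ 3 * n ^ 3)) + n * (D * (n * n))
      ≡⟨ cong (λ x → n * (D * (n * n) + n * n * x) + n * (D * (n * n))) (^-distribˡ-+-* n 3 3) ⟨
    n * (D * (n * n) + n * n * D) + n * (D * (n * n))
      ≡⟨ lemma₂ n D ⟩
    3 * (D * (n * (n * (n * 1))))
      ≤⟨ *-monoˡ-≤ (D * n ^ 3) (n≤1+n 3) ⟩
    4 * (D * n ^ 3) ∎)
    where
    lemma₁ : ∀ P n D N c K → 4 * (P * (n * (D * n) + n * n * (N * c + D * K))) ≡ 4 * P * (D * (n * n) + n * n * (c * N)) + 4 * (P * K) * (D * (n * n))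
    lemma₁ = solve-∀
    lemma₂ : ∀ n D → n * (D * (n * n) + n * n * D) + n * (D * (n * n)) ≡ 3 * (D * (n * (n * (n * 1))))
    lemma₂ = solve-∀

-- The probability that all pairs merge

merge-sym : ∀ {A : Automaton n} {ℓ x y} → MergeWithin A ℓ x y → MergeWithin A ℓ y x
merge-sym (ω , ω≤ℓ , eq) = ω , ω≤ℓ , sym eq

Sink : Automaton n → Fin n → Set
Sink A s = δ A a s ≡ s × δ A b s ≡ s

module Assembly (n q p k : ℕ) (p+100≤q : p + 100 ≤ q) (14≤k : 14 ≤ k)
  (lo : 2 ^ (12 * q + (16 + k)) ≤ n) (hi : n ≤ 2 ^ (12 * q + 42)) (big : 6 * (12 * q + 42) ≤ 2 ^ p) where

  open Parameters n q p k p+100≤q 14≤k lo hi big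

  instance
    n≢0 : NonZero n
    n≢0 = >-nonZero (≤-trans (m^n>0 2 (12 * q + (16 + k))) lo)
    D≢0 : NonZero D
    D≢0 = m^n≢0 n 6

  Unmerged : Fin n → Fin n → Automaton n → Set
  Unmerged x y A = ¬ MergeWithin A ⌊3log₂ n ⌋ x y × (∀ s → ¬ Sink A s)

  module _ (Q : Automaton n → Set) (noSink : ∀ {A} → Q A → ∀ s → δ A a s ≡ s → ¬ δ A b s ≡ s) where

    finish : ∀ x y → (∀ {A} → Q A → ¬ MergeWithin A ⌊3log₂ n ⌋ x y) → Opening.Finish Q N D (suc q) noSink x y
    finish x y Q⇒¬merge {σ} {Z} {ts} c ≤|ts| |Z|≤ =
      Growth.grow [ x ] [ y ] [] Q D 14≤k (5 * q) (β * β * (3 * q + 2) + 1) {ζ = 10} U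
        (Growth.conf-take [ x ] [ y ] [] (2 * U) c)
        -- The `suc q` levels have produced at least `2 ^ suc q = 2 * U` branches.
        (trans (length-take (2 * U) ts) (m≤n⇒m⊓n≡m (≤-trans (≤-reflexive (sym (*-identityʳ (2 * U)))) ≤|ts|)))
        (≤-trans |Z|≤ h≤) capacity₁ (D≤ p≤q)
        λ c' |ts'|≡ |Z'|≤ → Leaves.leaves x y Q ⌊3log₂ n ⌋ Q⇒¬merge D 14≤k (3 * q) β (2 ^ (5 * q + 4)) (2 ^ (2 * q)) X
          (2 * (4 ^ (5 * q) * U)) {ζ = ζ} c' |Z'|≤ blocks capacity₂ (D≤ (≤-trans p≤q (≤-trans (m≤n*m q 5) (m≤m+n (5 * q) 4))))
          sparse collisions (≤-reflexive (sym |ts'|≡)) hits length≤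

  unmerged-bound : ∀ x y → x ≢ y → Bnd [] (Unmerged x y) (N * n ^ 3 + D * (14 * κ ^ 3)) (D * n ^ 3)
  unmerged-bound x y x≢y = Error.err (Cost.toErr (Opening.opening Q N D (suc q) noSink x y x≢y
    (finish Q noSink x y proj₁) (finish Q noSink y x (λ (¬m , _) m → ¬m (merge-sym m))) separates))
    where
    Q = Unmerged x y
    noSink : ∀ {A} → Q A → ∀ s → δ A a s ≡ s → ¬ δ A b s ≡ s
    noSink (_ , ¬sink) s as bs = ¬sink s (as , bs)
    separates : ∀ {A} → Q A → δ A a x ≢ δ A a y
    separates (¬m , _) eq = ¬m (a ∷ [] , ≤-trans (s≤s z≤n) length≤ , eq)

  -- Two prescribed values have probability `1 / n ^ 2`; the fraction is expanded to the denominator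
  -- of `unmerged-bound`.
  sink-bound : ∀ s → Bnd [] (λ A → Sink A s) (D * n) (D * n ^ 3)
  sink-bound s = bnd-≤ {N = D} {D = D * n ^ 2} {N' = D * n} {D' = D * n ^ 3} (≤-reflexive (lemma D n)) (mkBnd bound′)
    where
    σ : Partial n
    σ = ((a , s) , s) ∷ ((b , s) , s) ∷ []
    lemma : ∀ D n → D * (D * (n * (n * (n * 1)))) ≡ D * n * (D * (n * (n * 1)))
    lemma = solve-∀
    instance
      _ : NonZero (D * n ^ 2)
      _ = m*n≢0 D (n ^ 2) {{D≢0}} {{m^n≢0 n 2}}
    bound′ : ∀ xs → Unique xs → All (λ A → A ⊨ [] × Sink A s) xs → D * n ^ 2 * (1 * length xs) ≤ D * n ^ (2 * n)
    bound′ xs xs! sinks = begin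
      D * n ^ 2 * (1 * length xs)     ≡⟨ lemma′ D (n ^ 2) (length xs) ⟩
      D * (n ^ 2 * length xs)         ≤⟨ *-monoʳ-≤ D (length-⊨ σ (((λ ()) ∷ []) ∷ [] ∷ []) xs xs! (All.map (λ (_ , as , bs) → as ∷ bs ∷ []) sinks)) ⟩
      D * n ^ (2 * n)                 ∎
      where
      open ≤-Reasoning
      lemma′ : ∀ d x l → d * x * (1 * l) ≡ d * (x * l)
      lemma′ = solve-∀

  -- Automata with a sink are split off first, because the opening relies on the absence of sinks;
  -- the others are covered by a union bound over pairs of states.
  bad-bound : Bnd [] (λ A → ¬ AllPairsMerge n A) 1 (2 ^ p)
  bad-bound = bnd-≤ {{m*n≢0 D (n ^ 3) {{D≢0}} {{m^n≢0 n 3}}}}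
    (≤-trans (≤-reflexive (*-comm _ (2 ^ p))) (≤-trans total (≤-reflexive (sym (*-identityˡ _)))))
    (bnd-⊎ cases
      (subst (λ l → Bnd [] (λ A → ∃ λ s → s ∈ allFin n × Sink A s) (l * (D * n)) (D * n ^ 3)) (length-tabulate {n = n} id) (bnd-∃ (allFin n) sink-bound))
      (subst (λ l → Bnd [] SomePair (l * (N * n ^ 3 + D * (14 * κ ^ 3))) (D * n ^ 3)) length-pairs (bnd-∃ pairs pair-bound)))
    where
    pairs = cartesianProduct (allFin n) (allFin n)
    length-pairs : length pairs ≡ n * n
    length-pairs = trans (length-cartesianProductWith _,_ (allFin n) (allFin n)) (cong₂ _*_ (length-tabulate {n = n} id) (length-tabulate {n = n} id))
    Pair : Fin n × Fin n → Automaton n → Set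
    Pair (x , y) A = x ≢ y × Unmerged x y A
    SomePair : Automaton n → Set
    SomePair A = ∃ λ xy → xy ∈ pairs × Pair xy A
    pair-bound : ∀ xy → Bnd [] (Pair xy) (N * n ^ 3 + D * (14 * κ ^ 3)) (D * n ^ 3)
    pair-bound (x , y) with x Fin.≟ y
    ... | yes x≡y = bnd-absurd λ _ (x≢y , _) → x≢y x≡y
    ... | no  x≢y = bnd-weaken (λ _ → proj₂) (unmerged-bound x y x≢y)
    cases : ∀ {A} → ¬ AllPairsMerge n A → (∃ λ s → s ∈ allFin n × Sink A s) ⊎ SomePair A
    cases {A} ¬all with Fin.any? (λ s → (δ A a s Fin.≟ s) ×-dec (δ A b s Fin.≟ s))
    ... | yes (s , sink) = inj₁ (s , ∈-allFin s , sink)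
    ... | no  ¬sink with Fin.¬∀⟶∃¬ n (λ x → ∀ y → MergeWithin A ⌊3log₂ n ⌋ x y) (λ x → Fin.all? (λ y → mergeWithin? A ⌊3log₂ n ⌋ x y)) ¬all
    ...   | x , ¬x with Fin.¬∀⟶∃¬ n (λ y → MergeWithin A ⌊3log₂ n ⌋ x y) (λ y → mergeWithin? A ⌊3log₂ n ⌋ x y) ¬x
    ...     | y , ¬xy = inj₂ ((x , y) , ∈-cartesianProduct⁺ (∈-allFin x) (∈-allFin y) ,
                              (λ { refl → ¬xy ([] , z≤n , refl) }) , ¬xy , λ s sink → ¬sink (s , sink))

-- Consecutive intervals share an endpoint, so climbing from `Q` reaches the one containing `n`,
-- within `n` steps because `n < 2 ^ n`.
bracket : ∀ Q n → 2 ^ (12 * Q + 30) ≤ n → ∃ λ q → Q ≤ q × 2 ^ (12 * q + 30) ≤ n × n ≤ 2 ^ (12 * q + 42)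
bracket Q n lo with go n
  where
  go : ∀ r → (∃ λ q → Q ≤ q × 2 ^ (12 * q + 30) ≤ n × n ≤ 2 ^ (12 * q + 42)) ⊎ 2 ^ (12 * (r + Q) + 30) ≤ n
  go zero    = inj₂ lo
  go (suc r) with go r
  ... | inj₁ found = inj₁ found
  ... | inj₂ lo′ with ≤-total n (2 ^ (12 * (r + Q) + 42))
  ...   | inj₁ hi = inj₁ (r + Q , m≤n+m Q r , lo′ , hi)
  ...   | inj₂ lo″ = inj₂ (≤-trans (≤-reflexive (cong (2 ^_) (lemma (r + Q)))) lo″)
    where
    lemma : ∀ q → 12 * suc q + 30 ≡ 12 * q + 42
    lemma = solve-∀
... | inj₁ found = found
... | inj₂ lo′ = contradiction (≤-trans (<-≤-trans (m<2^m n) (^-monoʳ-≤ 2 (≤-trans (m≤m+n n Q) (≤-trans (m≤n*m (n + Q) 12) (m≤m+n _ 30))))) lo′) (<-irrefl refl)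

-- This is the hypothesis `big` for `p = i + 14` and `q = p + 100`.
exponential : ∀ i → 6 * (12 * (i + 114) + 42) ≤ 2 ^ (i + 14)
exponential zero    = ≤ᵇ⇒≤ (6 * (12 * 114 + 42)) (2 ^ 14) tt
exponential (suc i) = begin
  6 * (12 * (suc i + 114) + 42)           ≡⟨ lemma i ⟩
  6 * (12 * (i + 114) + 42) + 72          ≤⟨ +-mono-≤ (exponential i) (≤-trans (≤ᵇ⇒≤ 72 (2 ^ 14) tt) (^-monoʳ-≤ 2 (m≤n+m 14 i))) ⟩
  2 ^ (i + 14) + 2 ^ (i + 14)             ≡⟨ cong (2 ^ (i + 14) +_) (+-identityʳ _) ⟨
  2 ^ suc (i + 14)                        ∎
  where
  open ≤-Reasoning
  lemma : ∀ i → 6 * (12 * (suc i + 114) + 42) ≡ 6 * (12 * (i + 114) + 42) + 72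
  lemma = solve-∀

-- A positive `ε` is at least the reciprocal of its denominator, hence at least `1 / P`, which
-- bounds `e / t`.
1-ratio≤ : ∀ g e {t} .{{_ : NonZero t}} → g + e ≡ t → ∀ P {ε} → 0ℚᵘ ℚᵘ.< ε → ↧ₙ ε ≤ P → P * e ≤ t →
  ℚᵘ.∣ 1ℚᵘ - (ℤ.+ g ℚᵘ./ t) ∣ ℚᵘ.≤ ε
1-ratio≤ g e {suc t} g+e≡t P {mkℚᵘ (+[1+ m ]) d} _ d<P Pe≤t =
  ℚᵘ.≤-respˡ-≃ (ℚᵘ.∣-∣-cong (ℚᵘ.≃-sym complement)) (*≤* (+≤+′ (begin
    e * suc d             ≡⟨ *-comm e (suc d) ⟩
    suc d * e             ≤⟨ *-monoˡ-≤ e d<P ⟩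
    P * e                 ≤⟨ Pe≤t ⟩
    suc t                 ≤⟨ m≤n*m (suc t) (suc m) ⟩
    suc m * suc t         ∎)))
  where
  open ≤-Reasoning
  +≤+′ : e * suc d ≤ suc m * suc t → ℤ.+ e ℤ.* ℤ.+ suc d ℤ.≤ +[1+ m ] ℤ.* ℤ.+ suc t
  +≤+′ le = subst (ℤ._≤ +[1+ m ] ℤ.* ℤ.+ suc t) (ℤ.pos-* e (suc d)) (+≤+ le)
  numerator : ℤ.+ 1 ℤ.* ℤ.+ suc t ℤ.+ (ℤ.- (ℤ.+ g)) ℤ.* ℤ.+ 1 ≡ ℤ.+ e
  numerator = trans (cong₂ ℤ._+_ (ℤ.*-identityˡ (ℤ.+ suc t)) (ℤ.*-identityʳ (ℤ.- (ℤ.+ g))))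
    (trans (cong (λ x → ℤ.+ x ℤ.+ (ℤ.- (ℤ.+ g))) (trans (sym g+e≡t) (+-comm g e)))
    (trans (cong (ℤ._+ (ℤ.- (ℤ.+ g))) (ℤ.pos-+ e g))
    (trans (ℤ.+-assoc (ℤ.+ e) (ℤ.+ g) (ℤ.- (ℤ.+ g)))
    (trans (cong (λ x → ℤ.+ e ℤ.+ x) (ℤ.+-inverseʳ (ℤ.+ g))) (ℤ.+-identityʳ (ℤ.+ e))))))
  complement : 1ℚᵘ - (ℤ.+ g ℚᵘ./ suc t) ℚᵘ.≃ mkℚᵘ (ℤ.+ e) t
  complement = *≡* (cong₂ ℤ._*_ numerator (cong (λ x → ℤ.+ suc x) (sym (+-identityʳ t))))
1-ratio≤ g e _ P {mkℚᵘ (ℤ.+ 0) d}      (*<* (+<+ ())) _ _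
1-ratio≤ g e _ P {mkℚᵘ (-[1+ m ]) d} (*<* ()) _ _

theorem1p3 : IsO[1] (λ n → 1ℚᵘ - Pr n {AllPairsMerge n} (allPairsMerge? n))
theorem1p3 ε 0<ε = 2 ^ (12 * Q + 30) , λ n n≥ → close n (bracket Q n n≥)
  where
  -- With `q = p + 100` this makes `p` at least `↧ₙ ε + 14`: the summand `↧ₙ ε` brings `1 / 2 ^ p`
  -- below `ε`, and 14 is where `exponential` starts.
  Q = ↧ₙ ε + 114
  close : ∀ n → (∃ λ q → Q ≤ q × 2 ^ (12 * q + 30) ≤ n × n ≤ 2 ^ (12 * q + 42)) →
    ℚᵘ.∣ 1ℚᵘ - Pr n {AllPairsMerge n} (allPairsMerge? n) ∣ ℚᵘ.≤ ε
  close n (q , Q≤q , lo , hi) with m≤n⇒∃[o]m+o≡n Q≤q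
  ... | r , refl = 1-ratio≤ (length good) (length bad) {{n^2n≢0 n}} (trans (length-filter-¬ (allPairsMerge? n) (automata n)) (length-automata n))
      (2 ^ p) 0<ε (≤-trans (≤-trans (m≤n+m (↧ₙ ε) r) (m≤m+n (r + ↧ₙ ε) 14)) (<⇒≤ (m<2^m p))) small
    where
    p = r + ↧ₙ ε + 14
    good = filter (allPairsMerge? n) (automata n)
    bad = filter (λ A → ¬? (allPairsMerge? n A)) (automata n)
    q≡ : Q + r ≡ r + ↧ₙ ε + 114
    q≡ = trans (+-comm Q r) (sym (+-assoc r (↧ₙ ε) 114))
    p+100≡ : p + 100 ≡ Q + r
    p+100≡ = trans (+-assoc (r + ↧ₙ ε) 14 100) (sym q≡)
    -- The choice `k = 14` is the least allowed and turns `16 + k` into the 30 of `bracket`.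
    open Assembly n (Q + r) p 14 (≤-reflexive p+100≡) ≤-refl lo hi
      (≤-trans (≤-reflexive (cong (λ q → 6 * (12 * q + 42)) q≡)) (exponential (r + ↧ₙ ε)))
    small : 2 ^ p * length bad ≤ n ^ (2 * n)
    small = begin
      2 ^ p * length bad           ≡⟨ cong (2 ^ p *_) (*-identityˡ (length bad)) ⟨
      2 ^ p * (1 * length bad)     ≤⟨ Bnd.bound bad-bound bad (Unique.filter⁺ _ (automata-unique n))
                                        (All.map ([] ,_) (All.all-filter (λ A → ¬? (allPairsMerge? n A)) (automata n))) ⟩
      1 * n ^ (2 * n)              ≡⟨ *-identityˡ _ ⟩
      n ^ (2 * n)                  ∎
      where open ≤-Reasoning
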